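{- The generating function $R(x)=\sum_{n\geq 0}|I_n(100,012)|\,x^{n+1}$ is given by $$R(x)=\frac{x(x^6-x^5-3x^4+x^3+3x^2-3x+1)}{(1-x)^3(1-x-x^2)^2}=x+2x^2+5x^3+12x^4+27x^5+56x^6+110x^7+207x^8+378x^9+675x^{10}+\cdots.$$ Moreover, for all $n\geq 0$, $$|I_n(100,012)|=\frac{(n+7)\,\mathrm{Fib}_n+15\,\mathrm{Fib}_{n+1}+n\,\mathrm{Fib}_{n+2}}{5}-1-\binom{n+2}{2},$$ where $\mathrm{Fib}_n$ is the $n$th Fibonacci number.
   Context: For $n\ge 0$, $I_n$ denotes the set of inversion sequences $e=e_0e_1\cdots e_n$, i.e. integer sequences with $0\le e_i\le i$ for each $0\le i\le n$ (so elements of $I_n$ have $n+1$ letters). An inversion sequence contains a pattern (word) $\tau$ of length $k$ if it has a subsequence (not necessarily consecutive) of length $k$ that is order isomorphic to $\tau$ (same relative order, including equalities); otherwise it avoids $\tau$. $I_n(\tau_1,\dots,\tau_m)$ is the set of $e\in I_n$ avoiding all of $\tau_1,\dots,\tau_m$. Fibonacci numbers: $\mathrm{Fib}_0=0$, $\mathrm{Fib}_1=1$, $\mathrm{Fib}_n=\mathrm{Fib}_{n-1}+\mathrm{Fib}_{n-2}$.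
   Formalization: The closed formula as printed is off by one (at n=1 it gives 1, but |I_1(100,012)|=2); the formal statement proves it for all n≥0 with n replaced by n+1 on the right-hand side. The generating function and its expansion are unchanged. -}

module Defs where

open import Algebra.Properties.Semiring.Sum using (sum)
open import Data.Fin using (Fin; zero; suc; toℕ; inject₁; fromℕ)
import Data.Fin as Fin
import Data.Fin.Properties as Fin
open import Data.Integer using (ℤ; +_; 0ℤ; 1ℤ)
import Data.Integer as ℤ
import Data.Integer.Properties as ℤ
open import Data.List using (List; []; _∷_; length; filter; upTo; cartesianProductWith)
open import Data.List.Membership.Propositional using (_∈_)
open import Data.List.Membership.Propositional.Properties
  using (∈-filter⁺; ∈-filter⁻; ∈-upTo⁺; ∈-upTo⁻; ∈-cartesianProductWith⁺; ∈-cartesianProductWith⁻)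
open import Data.List.Relation.Unary.All as All using (All)
import Data.List.Relation.Unary.AllPairs as ListAllPairs
open import Data.List.Relation.Unary.Any using (here)
open import Data.List.Relation.Unary.Unique.Propositional using (Unique)
import Data.List.Relation.Unary.Unique.Propositional.Properties as Unique
open import Data.Nat using (ℕ; zero; suc; _+_; _∸_; _≤_; _<_; _≟_; _<?_; _≤?_; s≤s; s≤s⁻¹)
open import Data.Product using (∃; ∃-syntax; _×_; _,_; proj₁; proj₂; uncurry)
open import Data.Vec using (Vec; []; _∷_; _∷ʳ_; lookup; map; fromList; initLast)
open import Data.Vec.Properties using (∷ʳ-injective)
open import Data.Vec.Relation.Unary.AllPairs as AllPairs using (AllPairs)
open import Function using (_⇔_; mk⇔; Equivalence)
open import Relation.Binary.PropositionalEquality using (_≡_; refl; sym; cong; subst; subst₂)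
open import Relation.Nullary using (Dec; yes; no; ¬_; ¬?)
open import Relation.Nullary.Decidable using (map′; _×-dec_; _→-dec_)
open import Relation.Unary using (Decidable)

------------------------------------------------------------------------
-- Inversion sequences and pattern avoidance

-- Positions are numbered from 0.
IsInversionSequence : ∀ {n} → Vec ℕ n → Set
IsInversionSequence {n} e = (i : Fin n) → lookup e i ≤ toℕ i

OrderIsomorphic : ∀ {k} → Vec ℕ k → Vec ℕ k → Set
OrderIsomorphic {k} s t = (i j : Fin k) →
  (lookup s i < lookup s j ⇔ lookup t i < lookup t j) ×
  (lookup s i ≡ lookup s j ⇔ lookup t i ≡ lookup t j)

-- p lists the (strictly increasing) positions of the subsequence.
IsOccurrence : ∀ {n} (τ : List ℕ) → Vec ℕ n → Vec (Fin n) (length τ) → Set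
IsOccurrence τ e p = AllPairs Fin._<_ p × OrderIsomorphic (map (lookup e) p) (fromList τ)

Contains : ∀ {n} → List ℕ → Vec ℕ n → Set
Contains τ e = ∃[ p ] IsOccurrence τ e p

Avoids : ∀ {n} → List (List ℕ) → Vec ℕ n → Set
Avoids τs e = All (λ τ → ¬ Contains τ e) τs

------------------------------------------------------------------------
-- Avoidance is decidable

_⇔-dec_ : ∀ {A B : Set} → Dec A → Dec B → Dec (A ⇔ B)
a? ⇔-dec b? = map′ (uncurry mk⇔) (λ eq → Equivalence.to eq , Equivalence.from eq)
  ((a? →-dec b?) ×-dec (b? →-dec a?))

orderIsomorphic? : ∀ {k} (s t : Vec ℕ k) → Dec (OrderIsomorphic s t)
orderIsomorphic? s t = Fin.all? λ i → Fin.all? λ j →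
  ((lookup s i <? lookup s j) ⇔-dec (lookup t i <? lookup t j)) ×-dec
  ((lookup s i ≟ lookup s j) ⇔-dec (lookup t i ≟ lookup t j))

isOccurrence? : ∀ {n} (τ : List ℕ) (e : Vec ℕ n) → Decidable (IsOccurrence τ e)
isOccurrence? τ e p =
  AllPairs.allPairs? Fin._<?_ p ×-dec orderIsomorphic? (map (lookup e) p) (fromList τ)

anyVec? : ∀ {n} k {P : Vec (Fin n) k → Set} → Decidable P → Dec (∃ P)
anyVec? zero P? = map′ (λ p → [] , p) (λ { ([] , p) → p }) (P? [])
anyVec? (suc k) P? = map′
  (λ { (i , v , p) → i ∷ v , p })
  (λ { (i ∷ v , p) → i , v , p })
  (Fin.any? λ i → anyVec? k λ v → P? (i ∷ v))

avoids? : ∀ {n} (τs : List (List ℕ)) → Decidable (Avoids {n} τs)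
avoids? τs e = All.all? (λ τ → ¬? (anyVec? (length τ) (isOccurrence? τ e))) τs

------------------------------------------------------------------------
-- The finite sets Iₙ(τs)

-- All inversion sequences with n letters.
inversionSequences : ∀ n → List (Vec ℕ n)
inversionSequences zero = [] ∷ []
inversionSequences (suc n) = cartesianProductWith _∷ʳ_ (inversionSequences n) (upTo (suc n))

-- As the letters are e₀ e₁ … eₙ, the elements of Iₙ have n + 1 letters. This
-- matters for the closed formula in terms of Fibonacci numbers: its argument is
-- the number m = n + 1 of letters, not n.  At m = 0, 1, 2, 3, 4 it takes the
-- values 1, 1, 2, 5, 12, whereas ∣I₀∣, ∣I₁∣, ∣I₂∣, ∣I₃∣ are 1, 2, 5, 12.
I : (n : ℕ) → List (List ℕ) → List (Vec ℕ (suc n))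
I n τs = filter (avoids? τs) (inversionSequences (suc n))

∣I∣ : ℕ → List (List ℕ) → ℕ
∣I∣ n τs = length (I n τs)

-- I n τs lists every inversion sequence avoiding τs exactly once (I-complete
-- and I-unique below), so ∣I∣ is its cardinality.

lookup-∷ʳ-inject₁ : ∀ {n} (e : Vec ℕ n) x i → lookup (e ∷ʳ x) (inject₁ i) ≡ lookup e i
lookup-∷ʳ-inject₁ (_ ∷ _) x zero = refl
lookup-∷ʳ-inject₁ (_ ∷ e) x (suc i) = lookup-∷ʳ-inject₁ e x i

lookup-∷ʳ-fromℕ : ∀ {n} (e : Vec ℕ n) x → lookup (e ∷ʳ x) (fromℕ n) ≡ x
lookup-∷ʳ-fromℕ [] x = refl
lookup-∷ʳ-fromℕ (_ ∷ e) x = lookup-∷ʳ-fromℕ e x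

data Last {n} : Fin (suc n) → Set where
  inner : (i : Fin n) → Last (inject₁ i)
  last  : Last (fromℕ n)

last? : ∀ {n} (i : Fin (suc n)) → Last i
last? {zero} zero = last
last? {suc n} zero = inner zero
last? {suc n} (suc i) with last? i
... | inner j = inner (suc j)
... | last = last

isInversionSequence-∷ʳ : ∀ {n} (e : Vec ℕ n) x →
  IsInversionSequence (e ∷ʳ x) ⇔ (IsInversionSequence e × x ≤ n)
isInversionSequence-∷ʳ {n} e x = mk⇔
  (λ h → (λ i → subst₂ _≤_ (lookup-∷ʳ-inject₁ e x i) (Fin.toℕ-inject₁ i) (h (inject₁ i)))
       , subst₂ _≤_ (lookup-∷ʳ-fromℕ e x) (Fin.toℕ-fromℕ n) (h (fromℕ n)))
  (λ h i → from h (last? i))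
  where
  from : IsInversionSequence e × x ≤ n → ∀ {i} → Last i → lookup (e ∷ʳ x) i ≤ toℕ i
  from (h , _) (inner i) =
    subst₂ _≤_ (sym (lookup-∷ʳ-inject₁ e x i)) (sym (Fin.toℕ-inject₁ i)) (h i)
  from (_ , b) last =
    subst₂ _≤_ (sym (lookup-∷ʳ-fromℕ e x)) (sym (Fin.toℕ-fromℕ n)) b

inversionSequences-sound : ∀ n {e} → e ∈ inversionSequences n → IsInversionSequence e
inversionSequences-sound zero _ ()
inversionSequences-sound (suc n) e∈
  with e , x , e∈′ , x∈ , refl ← ∈-cartesianProductWith⁻ _∷ʳ_ (inversionSequences n) _ e∈
  = Equivalence.from (isInversionSequence-∷ʳ e x)
      (inversionSequences-sound n e∈′ , s≤s⁻¹ (∈-upTo⁻ x∈))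

inversionSequences-complete : ∀ n {e} → IsInversionSequence e → e ∈ inversionSequences n
inversionSequences-complete zero {[]} _ = here refl
inversionSequences-complete (suc n) {e} h with initLast e
... | e′ , x , refl with h′ , x≤n ← Equivalence.to (isInversionSequence-∷ʳ e′ x) h
  = ∈-cartesianProductWith⁺ _∷ʳ_ (inversionSequences-complete n h′) (∈-upTo⁺ (s≤s x≤n))

inversionSequences-unique : ∀ n → Unique (inversionSequences n)
inversionSequences-unique zero = All.[] ListAllPairs.∷ ListAllPairs.[]
inversionSequences-unique (suc n) = Unique.cartesianProductWith⁺ _∷ʳ_
  (λ {e} {e′} eq → ∷ʳ-injective e e′ eq)
  (inversionSequences-unique n) (Unique.upTo⁺ (suc n))

I-complete : ∀ n τs {e} → e ∈ I n τs ⇔ (IsInversionSequence e × Avoids τs e)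
I-complete n τs = mk⇔
  (λ e∈ → let e∈′ , a = ∈-filter⁻ (avoids? τs) e∈
          in inversionSequences-sound (suc n) e∈′ , a)
  (λ (h , a) → ∈-filter⁺ (avoids? τs) (inversionSequences-complete (suc n) h) a)

I-unique : ∀ n τs → Unique (I n τs)
I-unique n τs = Unique.filter⁺ (avoids? τs) (inversionSequences-unique (suc n))

------------------------------------------------------------------------
-- Formal power series over ℤ, given by their coefficients

Series : Set
Series = ℕ → ℤ

infix  4 _≈_ _≈_÷_
infixl 6 _⊕_ _⊖_
infixl 7 _⊛_
infixr 8 _^_

_≈_ : Series → Series → Set
f ≈ g = ∀ n → f n ≡ g n

const : ℤ → Series
const c zero = c
const c (suc _) = 0ℤ

X : Series
X 1 = 1ℤ
X _ = 0ℤ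

_⊕_ _⊖_ _⊛_ : Series → Series → Series
(f ⊕ g) n = f n ℤ.+ g n
(f ⊖ g) n = f n ℤ.- g n
(f ⊛ g) n = sum ℤ.+-*-semiring {suc n} (λ i → f (toℕ i) ℤ.* g (n ∸ toℕ i))

_^_ : Series → ℕ → Series
f ^ zero = const 1ℤ
f ^ suc k = f ⊛ f ^ k

-- h = f / g : the denominator g is invertible in ℤ[[x]] and h = f g⁻¹.
_≈_÷_ : Series → Series → Series → Set
h ≈ f ÷ g = ∃[ g⁻¹ ] (g ⊛ g⁻¹ ≈ const 1ℤ) × (h ≈ f ⊛ g⁻¹)

-- ∑ₙ aₙ xⁿ⁺¹
shiftedGF : (ℕ → ℕ) → Series
shiftedGF a zero = 0ℤ
shiftedGF a (suc n) = + a n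

------------------------------------------------------------------------
-- The sequence ∣Iₙ(100,012)∣ and the Fibonacci numbers

Fib : ℕ → ℕ
Fib 0 = 0
Fib 1 = 1
Fib (suc (suc n)) = Fib (suc n) + Fib n

100-012 : List (List ℕ)
100-012 = (1 ∷ 0 ∷ 0 ∷ []) ∷ (0 ∷ 1 ∷ 2 ∷ []) ∷ []

R : Series
R = shiftedGF (λ n → ∣I∣ n 100-012)

{-# OPTIONS --safe #-}
module Submission where

-- Since e₀ = 0, an inversion sequence avoids 012 exactly when its nonzero letters
-- are weakly decreasing. If it also avoids 100, then only the largest letter can be
-- repeated among the nonzero ones, and at most one 0 comes after the first nonzero
-- letter. So, reading from left to right, the letters that may be appended to an
-- avoiding word depend only on its last nonzero letter m + 1, on whether that letter
-- may be repeated and on whether a 0 is still allowed (the record Ends). The number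
-- of ways to append r letters is therefore a function of these data and r, and it is
-- an expression in binomial coefficients (completions-Ends, tails-suc): strictly
-- decreasing words with r letters from 1, …, m number m C r, preceding them by copies
-- of m + 1 turns this into the partial sum S m r = m C 0 + ⋯ + m C r, and one optional
-- 0 in any of the r places gives S m r + r * S m (r - 1).
--
-- Let T n be the number of avoiding words with n letters. Prefixing a 0 to such a
-- word gives all those with n + 1 letters except the ones whose first nonzero letter
-- is equal to its position. Their number U n is the sum of S m r + r * S m (r - 1)
-- over m + r = n - 1. Pascal's rule turns such diagonal sums into the recurrence
-- (U-suc-suc)
--   U (n + 2) = U (n + 1) + U n + Fib (n + 1) + n + 1,
-- and T (n + 1) = T n + U n. The closed formula follows by induction, and the
-- recurrences say that multiplying R by 1 - X, twice by 1 - X - X² and twice more by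
-- 1 - X leaves the polynomial in the numerator (R-quotient). The two factors have
-- the inverses ∑ Xⁿ and ∑ Fib (n + 1) Xⁿ.

open import Defs
open import Algebra.Bundles using (CommutativeMonoid)
import Algebra.Solver.CommutativeMonoid as CommutativeMonoidSolver
open import Data.Bool using (Bool; true; false; if_then_else_)
open import Data.Empty using (⊥-elim)
open import Data.Fin using (Fin; zero; suc; toℕ; inject₁; fromℕ)
import Data.Fin as Fin
import Data.Fin.Properties as Fin
open import Data.Integer using (ℤ; +_; 0ℤ; 1ℤ; -[1+_])
import Data.Integer as ℤ
import Data.Integer.Properties as ℤ
import Data.Integer.Tactic.RingSolver as ℤ
open import Data.List
  using (List; []; _∷_; _++_; map; upTo; applyUpTo; filter; length; cartesianProductWith)
open import Data.List.Properties
  using (map-++; map-∘; map-cong; map-upTo; length-++; filter-++; filter-accept; filter-reject)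
open import Data.List.Relation.Unary.All using ([]; _∷_)
open import Data.Nat using (ℕ; zero; suc; _+_; _*_; _≤_; _<_; z≤n; s≤s; s≤s⁻¹; z<s; s<s; s<s⁻¹)
open import Data.Nat.Combinatorics using (_C_; nCk+nC[k+1]≡[n+1]C[k+1]; nC1≡n)
open import Data.Nat.ListAction using (sum)
open import Data.Nat.ListAction.Properties using (sum-++)
open import Data.Nat.Properties
open import Data.Nat.Tactic.RingSolver using (solve-∀)
open import Data.Product using (_×_; _,_; proj₁; proj₂)
open import Data.Rational using (_/_; _-_; 1ℚ; toℚᵘ)
import Data.Rational as ℚ
import Data.Rational.Properties as ℚ
open import Data.Rational.Unnormalised using (mkℚᵘ; *≡*)
import Data.Rational.Unnormalised as ℚᵘ
import Data.Rational.Unnormalised.Properties as ℚᵘ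
open import Data.Sum using (_⊎_; inj₁; inj₂; [_,_]; [_,_]′; map₂)
open import Data.Vec using (Vec; []; _∷_; _∷ʳ_; lookup)
import Data.Vec as Vec
open import Data.Vec.Relation.Unary.All using ([]; _∷_)
open import Data.Vec.Relation.Unary.AllPairs using ([]; _∷_)
open import Function using (_∘_; _⇔_; mk⇔; Equivalence)
open import Level using (0ℓ)
open import Relation.Binary.PropositionalEquality
  using (_≡_; refl; sym; trans; cong; cong₂; subst; subst₂; module ≡-Reasoning)
open import Relation.Nullary using (¬_)

open Equivalence using (to; from)

------------------------------------------------------------------------
-- Entries and ordered pairs of entries of a word with a letter appended

-- Some entry a satisfies P a.
record Some {n} (P : ℕ → Set) (e : Vec ℕ n) : Set where
  constructor some
  field
    position : Fin n
    holds    : P (lookup e position)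

-- Some entry a and some later entry b satisfy P a b.
record Pair {n} (P : ℕ → ℕ → Set) (e : Vec ℕ n) : Set where
  constructor pair
  field
    first second : Fin n
    ordered      : first Fin.< second
    holds        : P (lookup e first) (lookup e second)

inject₁<fromℕ : ∀ {n} (i : Fin n) → inject₁ i Fin.< fromℕ n
inject₁<fromℕ i = subst₂ _<_ (sym (Fin.toℕ-inject₁ i)) (sym (Fin.toℕ-fromℕ _)) (Fin.toℕ<n i)

inject₁-mono-< : ∀ {n} {i j : Fin n} → i Fin.< j → inject₁ i Fin.< inject₁ j
inject₁-mono-< {i = i} {j} = subst₂ _<_ (sym (Fin.toℕ-inject₁ i)) (sym (Fin.toℕ-inject₁ j))

inject₁-cancel-< : ∀ {n} {i j : Fin n} → inject₁ i Fin.< inject₁ j → i Fin.< j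
inject₁-cancel-< {i = i} {j} = subst₂ _<_ (Fin.toℕ-inject₁ i) (Fin.toℕ-inject₁ j)

fromℕ≮ : ∀ {n} (j : Fin (suc n)) → ¬ fromℕ n Fin.< j
fromℕ≮ {n} j n<j = <⇒≱ n<j (subst (toℕ j ≤_) (sym (Fin.toℕ-fromℕ n)) (s≤s⁻¹ (Fin.toℕ<n j)))

Some-∷ʳ : ∀ {n} {P : ℕ → Set} (e : Vec ℕ n) x → Some P (e ∷ʳ x) ⇔ (Some P e ⊎ P x)
Some-∷ʳ {P = P} e x = mk⇔ (λ (some i p) → split (last? i) p) [ old , new ]
  where
  split : ∀ {i} → Last i → P (lookup (e ∷ʳ x) i) → Some P e ⊎ P x
  split (inner i) p = inj₁ (some i (subst P (lookup-∷ʳ-inject₁ e x i) p))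
  split last p = inj₂ (subst P (lookup-∷ʳ-fromℕ e x) p)
  old : Some P e → Some P (e ∷ʳ x)
  old (some i p) = some (inject₁ i) (subst P (sym (lookup-∷ʳ-inject₁ e x i)) p)
  new : P x → Some P (e ∷ʳ x)
  new p = some (fromℕ _) (subst P (sym (lookup-∷ʳ-fromℕ e x)) p)

Pair-∷ʳ : ∀ {n} {P : ℕ → ℕ → Set} (e : Vec ℕ n) x →
  Pair P (e ∷ʳ x) ⇔ (Pair P e ⊎ Some (λ a → P a x) e)
Pair-∷ʳ {P = P} e x = mk⇔ (λ (pair i j i<j p) → split (last? i) (last? j) i<j p) [ old , new ]
  where
  at : ∀ i → lookup (e ∷ʳ x) (inject₁ i) ≡ lookup e i
  at = lookup-∷ʳ-inject₁ e x
  end : lookup (e ∷ʳ x) (fromℕ _) ≡ x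
  end = lookup-∷ʳ-fromℕ e x
  split : ∀ {i j} → Last i → Last j → i Fin.< j →
    P (lookup (e ∷ʳ x) i) (lookup (e ∷ʳ x) j) → Pair P e ⊎ Some (λ a → P a x) e
  split (inner i) (inner j) i<j p = inj₁ (pair i j (inject₁-cancel-< i<j) (subst₂ P (at i) (at j) p))
  split (inner i) last _ p = inj₂ (some i (subst₂ P (at i) end p))
  split last _ i<j _ = ⊥-elim (fromℕ≮ _ i<j)
  old : Pair P e → Pair P (e ∷ʳ x)
  old (pair i j i<j p) =
    pair (inject₁ i) (inject₁ j) (inject₁-mono-< i<j) (subst₂ P (sym (at i)) (sym (at j)) p)
  new : Some (λ a → P a x) e → Pair P (e ∷ʳ x)
  new (some i p) =
    pair (inject₁ i) (fromℕ _) (inject₁<fromℕ i) (subst₂ P (sym (at i)) (sym end) p)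

-- A new occurrence of a pattern with three letters uses the appended letter.
Contains-∷ʳ : ∀ {n} p q r (e : Vec ℕ n) x → let τ = p ∷ q ∷ r ∷ [] in
  Contains τ (e ∷ʳ x) ⇔
  (Contains τ e ⊎ Pair (λ a b → OrderIsomorphic (a ∷ b ∷ x ∷ []) (Vec.fromList τ)) e)
Contains-∷ʳ p q r e x = mk⇔
  (λ { (i ∷ j ∷ k ∷ [] , ((i<j ∷ i<k ∷ []) ∷ (j<k ∷ []) ∷ [] ∷ []) , iso) →
       split (last? i) (last? j) (last? k) i<j i<k j<k iso })
  [ old , new ]
  where
  τ = p ∷ q ∷ r ∷ []
  at : ∀ i → lookup (e ∷ʳ x) (inject₁ i) ≡ lookup e i
  at = lookup-∷ʳ-inject₁ e x
  end : lookup (e ∷ʳ x) (fromℕ _) ≡ x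
  end = lookup-∷ʳ-fromℕ e x
  transport : ∀ {a a′ b b′ c c′ : ℕ} → a ≡ a′ → b ≡ b′ → c ≡ c′ →
    OrderIsomorphic (a ∷ b ∷ c ∷ []) (Vec.fromList τ) →
    OrderIsomorphic (a′ ∷ b′ ∷ c′ ∷ []) (Vec.fromList τ)
  transport refl refl refl iso = iso
  split : ∀ {i j k} → Last i → Last j → Last k → i Fin.< j → i Fin.< k → j Fin.< k →
    OrderIsomorphic (Vec.map (lookup (e ∷ʳ x)) (i ∷ j ∷ k ∷ [])) (Vec.fromList τ) →
    Contains τ e ⊎ Pair (λ a b → OrderIsomorphic (a ∷ b ∷ x ∷ []) (Vec.fromList τ)) e
  split (inner i) (inner j) (inner k) i<j i<k j<k iso = inj₁
    ( i ∷ j ∷ k ∷ []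
    , ((inject₁-cancel-< i<j ∷ inject₁-cancel-< i<k ∷ []) ∷ (inject₁-cancel-< j<k ∷ []) ∷ [] ∷ [])
    , transport (at i) (at j) (at k) iso)
  split (inner i) (inner j) last i<j _ _ iso =
    inj₂ (pair i j (inject₁-cancel-< i<j) (transport (at i) (at j) end iso))
  split last _ _ i<j _ _ _ = ⊥-elim (fromℕ≮ _ i<j)
  split (inner _) last _ _ _ j<k _ = ⊥-elim (fromℕ≮ _ j<k)
  old : Contains τ e → Contains τ (e ∷ʳ x)
  old (i ∷ j ∷ k ∷ [] , ((i<j ∷ i<k ∷ []) ∷ (j<k ∷ []) ∷ [] ∷ []) , iso) =
      inject₁ i ∷ inject₁ j ∷ inject₁ k ∷ []
    , ((inject₁-mono-< i<j ∷ inject₁-mono-< i<k ∷ []) ∷ (inject₁-mono-< j<k ∷ []) ∷ [] ∷ [])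
    , transport (sym (at i)) (sym (at j)) (sym (at k)) iso
  new : Pair (λ a b → OrderIsomorphic (a ∷ b ∷ x ∷ []) (Vec.fromList τ)) e → Contains τ (e ∷ʳ x)
  new (pair i j i<j iso) =
      inject₁ i ∷ inject₁ j ∷ fromℕ _ ∷ []
    , ((inject₁-mono-< i<j ∷ inject₁<fromℕ i ∷ []) ∷ (inject₁<fromℕ j ∷ []) ∷ [] ∷ [])
    , transport (sym (at i)) (sym (at j)) (sym end) iso

------------------------------------------------------------------------
-- The letters that complete an occurrence of 100 or of 012

-- e contains a descent a > y ending in the letter y: appending y creates 100.
Drop : ∀ {n} → ℕ → Vec ℕ n → Set
Drop y = Pair (λ a b → y < a × b ≡ y)

-- e contains an ascent a < b below y: appending y creates 012.
Rise : ∀ {n} → ℕ → Vec ℕ n → Set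
Rise y = Pair (λ a b → a < b × b < y)

Pair-⇔ : ∀ {n} {P Q : ℕ → ℕ → Set} (e : Vec ℕ n) → (∀ a b → P a b ⇔ Q a b) → Pair P e ⇔ Pair Q e
Pair-⇔ e eqv = mk⇔ (λ (pair i j i<j p) → pair i j i<j (to (eqv _ _) p))
                    (λ (pair i j i<j p) → pair i j i<j (from (eqv _ _) p))

iso-100 : ∀ x a b →
  OrderIsomorphic (a ∷ b ∷ x ∷ []) (1 ∷ 0 ∷ 0 ∷ []) ⇔ (x < a × b ≡ x)
iso-100 x a b = mk⇔
  (λ iso → from (proj₁ (iso (suc (suc zero)) zero)) (s≤s z≤n)
         , from (proj₂ (iso (suc zero) (suc (suc zero)))) refl)
  λ { (x<a , refl) → iso x<a }
  where
  iso : x < a → OrderIsomorphic (a ∷ x ∷ x ∷ []) (1 ∷ 0 ∷ 0 ∷ [])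
  iso x<a = λ
    { zero zero → same
    ; zero (suc zero) → above
    ; zero (suc (suc zero)) → above
    ; (suc zero) zero → below
    ; (suc (suc zero)) zero → below
    ; (suc zero) (suc zero) → same
    ; (suc zero) (suc (suc zero)) → same
    ; (suc (suc zero)) (suc zero) → same
    ; (suc (suc zero)) (suc (suc zero)) → same
    }
    where
    same : ∀ {y z : ℕ} → ((y < y) ⇔ (z < z)) × ((y ≡ y) ⇔ (z ≡ z))
    same = mk⇔ (⊥-elim ∘ <-irrefl refl) (⊥-elim ∘ <-irrefl refl) , mk⇔ (λ _ → refl) (λ _ → refl)
    above : ((a < x) ⇔ (1 < 0)) × ((a ≡ x) ⇔ (1 ≡ 0))
    above = mk⇔ (⊥-elim ∘ <-asym x<a) (λ ()) , mk⇔ (⊥-elim ∘ >⇒≢ x<a) (λ ())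
    below : ((x < a) ⇔ (0 < 1)) × ((x ≡ a) ⇔ (0 ≡ 1))
    below = mk⇔ (λ _ → s≤s z≤n) (λ _ → x<a) , mk⇔ (⊥-elim ∘ <⇒≢ x<a) (λ ())

iso-012 : ∀ x a b →
  OrderIsomorphic (a ∷ b ∷ x ∷ []) (0 ∷ 1 ∷ 2 ∷ []) ⇔ (a < b × b < x)
iso-012 x a b = mk⇔
  (λ iso → from (proj₁ (iso zero (suc zero))) (s≤s z≤n)
         , from (proj₁ (iso (suc zero) (suc (suc zero)))) (s≤s (s≤s z≤n)))
  λ (a<b , b<x) → λ
    { zero zero → same
    ; zero (suc zero) → below a<b (s≤s z≤n)
    ; zero (suc (suc zero)) → below (<-trans a<b b<x) (s≤s z≤n)
    ; (suc zero) zero → above a<b (s≤s z≤n)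
    ; (suc zero) (suc zero) → same
    ; (suc zero) (suc (suc zero)) → below b<x (s≤s (s≤s z≤n))
    ; (suc (suc zero)) zero → above (<-trans a<b b<x) (s≤s z≤n)
    ; (suc (suc zero)) (suc zero) → above b<x (s≤s (s≤s z≤n))
    ; (suc (suc zero)) (suc (suc zero)) → same
    }
  where
  same : ∀ {y z : ℕ} → ((y < y) ⇔ (z < z)) × ((y ≡ y) ⇔ (z ≡ z))
  same = mk⇔ (⊥-elim ∘ <-irrefl refl) (⊥-elim ∘ <-irrefl refl) , mk⇔ (λ _ → refl) (λ _ → refl)
  below : ∀ {y z s t : ℕ} → y < z → s < t → ((y < z) ⇔ (s < t)) × ((y ≡ z) ⇔ (s ≡ t))
  below y<z s<t = mk⇔ (λ _ → s<t) (λ _ → y<z)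
                , mk⇔ (⊥-elim ∘ <⇒≢ y<z) (⊥-elim ∘ <⇒≢ s<t)
  above : ∀ {y z s t : ℕ} → y < z → s < t → ((z < y) ⇔ (t < s)) × ((z ≡ y) ⇔ (t ≡ s))
  above y<z s<t = mk⇔ (⊥-elim ∘ <-asym y<z) (⊥-elim ∘ <-asym s<t)
                , mk⇔ (⊥-elim ∘ >⇒≢ y<z) (⊥-elim ∘ >⇒≢ s<t)

Contains-100-∷ʳ : ∀ {n} (e : Vec ℕ n) x → let τ = 1 ∷ 0 ∷ 0 ∷ [] in
  Contains τ (e ∷ʳ x) ⇔ (Contains τ e ⊎ Drop x e)
Contains-100-∷ʳ e x = mk⇔
  (map₂ (to (Pair-⇔ e (iso-100 x))) ∘ to (Contains-∷ʳ 1 0 0 e x))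
  (from (Contains-∷ʳ 1 0 0 e x) ∘ map₂ (from (Pair-⇔ e (iso-100 x))))

Contains-012-∷ʳ : ∀ {n} (e : Vec ℕ n) x → let τ = 0 ∷ 1 ∷ 2 ∷ [] in
  Contains τ (e ∷ʳ x) ⇔ (Contains τ e ⊎ Rise x e)
Contains-012-∷ʳ e x = mk⇔
  (map₂ (to (Pair-⇔ e (iso-012 x))) ∘ to (Contains-∷ʳ 0 1 2 e x))
  (from (Contains-∷ʳ 0 1 2 e x) ∘ map₂ (from (Pair-⇔ e (iso-012 x))))

Avoids-∷ʳ : ∀ {n} (e : Vec ℕ n) x →
  Avoids 100-012 (e ∷ʳ x) ⇔ (Avoids 100-012 e × ¬ Drop x e × ¬ Rise x e)
Avoids-∷ʳ e x = mk⇔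
  (λ { (no100 ∷ no012 ∷ []) →
       (no100 ∘ from (Contains-100-∷ʳ e x) ∘ inj₁) ∷ (no012 ∘ from (Contains-012-∷ʳ e x) ∘ inj₁) ∷ []
     , no100 ∘ from (Contains-100-∷ʳ e x) ∘ inj₂
     , no012 ∘ from (Contains-012-∷ʳ e x) ∘ inj₂ })
  (λ { (no100 ∷ no012 ∷ [] , noDrop , noRise) →
       ([ no100 , noDrop ]′ ∘ to (Contains-100-∷ʳ e x))
     ∷ ([ no012 , noRise ]′ ∘ to (Contains-012-∷ʳ e x))
     ∷ [] })

------------------------------------------------------------------------
-- Counting by completions of a prefix

-- f 0 + ⋯ + f (n - 1).
∑ : (ℕ → ℕ) → ℕ → ℕ
∑ f n = sum (applyUpTo f n)

-- The number of words avoiding τs that extend e by r letters, each new letter being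
-- at most its position.
completions : ∀ {n} → List (List ℕ) → Vec ℕ n → ℕ → ℕ
completions τs e zero = length (filter (avoids? τs) (e ∷ []))
completions {n} τs e (suc r) = ∑ (λ x → completions τs (e ∷ʳ x) r) (suc n)

∑-cong : ∀ {f g} n → (∀ x → x < n → f x ≡ g x) → ∑ f n ≡ ∑ g n
∑-cong zero h = refl
∑-cong (suc n) h = cong₂ _+_ (h 0 z<s) (∑-cong n λ x x<n → h (suc x) (s<s x<n))

∑-zero : ∀ {f} n → (∀ x → x < n → f x ≡ 0) → ∑ f n ≡ 0
∑-zero zero h = refl
∑-zero (suc n) h = cong₂ _+_ (h 0 z<s) (∑-zero n λ x x<n → h (suc x) (s<s x<n))

sum-cartesianProductWith : ∀ {A B C : Set} (w : C → ℕ) (f : A → B → C) xs ys →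
  sum (map w (cartesianProductWith f xs ys)) ≡ sum (map (λ x → sum (map (w ∘ f x) ys)) xs)
sum-cartesianProductWith w f [] ys = refl
sum-cartesianProductWith w f (x ∷ xs) ys = begin
  sum (map w (map (f x) ys ++ cartesianProductWith f xs ys))
    ≡⟨ cong sum (map-++ w (map (f x) ys) _) ⟩
  sum (map w (map (f x) ys) ++ map w (cartesianProductWith f xs ys))
    ≡⟨ sum-++ (map w (map (f x) ys)) _ ⟩
  sum (map w (map (f x) ys)) + sum (map w (cartesianProductWith f xs ys))
    ≡⟨ cong₂ _+_ (cong sum (sym (map-∘ ys))) (sum-cartesianProductWith w f xs ys) ⟩
  sum (map (w ∘ f x) ys) + sum (map (λ x → sum (map (w ∘ f x) ys)) xs) ∎
  where open ≡-Reasoning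

length-filter-sum : ∀ {n} τs (es : List (Vec ℕ n)) →
  length (filter (avoids? τs) es) ≡ sum (map (λ e → completions τs e 0) es)
length-filter-sum τs [] = refl
length-filter-sum τs (e ∷ es) = begin
  length (filter (avoids? τs) ((e ∷ []) ++ es))
    ≡⟨ cong length (filter-++ (avoids? τs) (e ∷ []) es) ⟩
  length (filter (avoids? τs) (e ∷ []) ++ filter (avoids? τs) es)
    ≡⟨ length-++ (filter (avoids? τs) (e ∷ [])) ⟩
  completions τs e 0 + length (filter (avoids? τs) es)
    ≡⟨ cong (λ z → completions τs e 0 + z) (length-filter-sum τs es) ⟩
  completions τs e 0 + sum (map (λ e → completions τs e 0) es) ∎
  where open ≡-Reasoning

sum-completions-suc : ∀ τs n r →
  sum (map (λ e → completions τs e r) (inversionSequences (suc n))) ≡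
  sum (map (λ e → completions τs e (suc r)) (inversionSequences n))
sum-completions-suc τs n r = trans
  (sum-cartesianProductWith (λ e → completions τs e r) _∷ʳ_ (inversionSequences n) (upTo (suc n)))
  (cong sum (map-cong (λ e → cong sum (map-upTo (λ x → completions τs (e ∷ʳ x) r) (suc n)))
    (inversionSequences n)))

-- Every inversion sequence with n letters contributes its own completions, so the
-- sum does not change when letters are moved from the prefix to the completion.
sum-completions : ∀ τs n r →
  sum (map (λ e → completions τs e r) (inversionSequences n)) ≡ completions τs [] (n + r)
sum-completions τs zero r = +-identityʳ _
sum-completions τs (suc n) r = trans (sum-completions-suc τs n r)
  (trans (sum-completions τs n (suc r)) (cong (completions τs []) (+-suc n r)))

∣I∣≡completions : ∀ n τs → ∣I∣ n τs ≡ completions τs [] (suc n)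
∣I∣≡completions n τs = trans (length-filter-sum τs (inversionSequences (suc n)))
  (trans (sum-completions τs (suc n) 0) (cong (completions τs []) (+-identityʳ (suc n))))

completions-avoiding : ∀ {n} τs (e : Vec ℕ n) → Avoids τs e → completions τs e 0 ≡ 1
completions-avoiding τs e av = cong length (filter-accept (avoids? τs) av)

completions-containing₀ : ∀ {n} τs (e : Vec ℕ n) → ¬ Avoids τs e → completions τs e 0 ≡ 0
completions-containing₀ τs e ¬av = cong length (filter-reject (avoids? τs) ¬av)

completions-containing : ∀ {n} (e : Vec ℕ n) r → ¬ Avoids 100-012 e → completions 100-012 e r ≡ 0
completions-containing e zero ¬av = completions-containing₀ 100-012 e ¬av
completions-containing {n} e (suc r) ¬av = ∑-zero (suc n) λ x _ →
  completions-containing (e ∷ʳ x) r (¬av ∘ proj₁ ∘ to (Avoids-∷ʳ e x))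

------------------------------------------------------------------------
-- The shape of an avoiding word

-- Whether the last nonzero letter v may be repeated: it may exactly when no letter
-- is larger.
Repeatable : ∀ {n} → Bool → ℕ → Vec ℕ n → Set
Repeatable true v e = ¬ Some (v <_) e
Repeatable false v e = Drop v e

-- Whether a further 0 may follow.
ZeroAllowed : ∀ {n} → Bool → Vec ℕ n → Set
ZeroAllowed true e = ¬ Drop 0 e
ZeroAllowed false e = Drop 0 e

-- What decides about the continuations of an avoiding word e with last nonzero letter
-- m + 1. As a 0 precedes that letter (ascent), larger letters would create 012; the
-- letters up to m + 1 do not (noRise). None of the letters 1, …, m would create 100
-- (noDrop). The flags rep and zer tell whether m + 1 and 0 may still be appended.
record Ends {n} (e : Vec ℕ n) (m : ℕ) (rep zer : Bool) : Set where
  field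
    inRange     : m < n
    avoids      : Avoids 100-012 e
    ascent      : Pair (λ a b → a ≡ 0 × b ≡ suc m) e
    noRise      : ¬ Rise (suc m) e
    noDrop      : ∀ u → u < m → ¬ Drop (suc u) e
    repeatable  : Repeatable rep (suc m) e
    zeroAllowed : ZeroAllowed zer e

open Ends

module _ {n m : ℕ} {e : Vec ℕ n} where

  hasZero : ∀ {rep zer} → Ends e m rep zer → Some (_≡ 0) e
  hasZero s with pair i _ _ (p , _) ← ascent s = some i p

  hasLast : ∀ {rep zer} → Ends e m rep zer → Some (_≡ suc m) e
  hasLast s with pair _ j _ (_ , p) ← ascent s = some j p

  private
    Pair-no : ∀ {P x} → ¬ Pair P e → ¬ Some (λ a → P a x) e → ¬ Pair P (e ∷ʳ x)
    Pair-no ¬p ¬q = [ ¬p , ¬q ]′ ∘ to (Pair-∷ʳ e _)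

    Pair-old : ∀ {P x} → Pair P e → Pair P (e ∷ʳ x)
    Pair-old = from (Pair-∷ʳ e _) ∘ inj₁

  append-zero : ∀ {rep} → Ends e m rep true → Ends (e ∷ʳ 0) m rep false
  append-zero {rep} s = record
    { inRange = m<n⇒m<1+n (inRange s)
    ; avoids = from (Avoids-∷ʳ e 0) (avoids s , zeroAllowed s , λ ())
    ; ascent = Pair-old (ascent s)
    ; noRise = Pair-no (noRise s) λ ()
    ; noDrop = λ u u<m → Pair-no (noDrop s u u<m) λ ()
    ; repeatable = rep-ok rep (repeatable s)
    ; zeroAllowed = from (Pair-∷ʳ e 0) (inj₂ positive)
    }
    where
    positive : Some (λ a → 0 < a × 0 ≡ 0) e
    positive with some i p ← hasLast s = some i (subst (0 <_) (sym p) z<s , refl)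
    rep-ok : ∀ rep → Repeatable rep (suc m) e → Repeatable rep (suc m) (e ∷ʳ 0)
    rep-ok true h = [ h , (λ ()) ]′ ∘ to (Some-∷ʳ e 0)
    rep-ok false h = Pair-old h

  append-repeated : ∀ {zer} → Ends e m true zer → Ends (e ∷ʳ suc m) m true zer
  append-repeated {zer} s = record
    { inRange = m<n⇒m<1+n (inRange s)
    ; avoids = from (Avoids-∷ʳ e _)
        (avoids s , (λ (pair i j _ (lt , _)) → repeatable s (some i lt)) , noRise s)
    ; ascent = Pair-old (ascent s)
    ; noRise = Pair-no (noRise s) λ (some _ (_ , lt)) → <-irrefl refl lt
    ; noDrop = λ u u<m → Pair-no (noDrop s u u<m) λ (some _ (_ , eq)) → >⇒≢ u<m (suc-injective eq)
    ; repeatable = [ repeatable s , <-irrefl refl ]′ ∘ to (Some-∷ʳ e _)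
    ; zeroAllowed = zer-ok zer (zeroAllowed s)
    }
    where
    zer-ok : ∀ zer → ZeroAllowed zer e → ZeroAllowed zer (e ∷ʳ suc m)
    zer-ok true h = Pair-no h λ ()
    zer-ok false h = Pair-old h

  append-smaller : ∀ {rep zer u} → u < m → Ends e m rep zer → Ends (e ∷ʳ suc u) u false zer
  append-smaller {zer = zer} {u} u<m s = record
    { inRange = m<n⇒m<1+n (<-trans u<m (inRange s))
    ; avoids = from (Avoids-∷ʳ e _) (avoids s , noDrop s u u<m , noRise-u)
    ; ascent = from (Pair-∷ʳ e _) (inj₂ zero-entry)
    ; noRise = Pair-no noRise-u λ (some _ (_ , lt)) → <-irrefl refl lt
    ; noDrop = λ w w<u → Pair-no (noDrop s w (<-trans w<u u<m))
        λ (some _ (_ , eq)) → >⇒≢ w<u (suc-injective eq)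
    ; repeatable = from (Pair-∷ʳ e _) (inj₂ larger-entry)
    ; zeroAllowed = zer-ok zer (zeroAllowed s)
    }
    where
    noRise-u : ¬ Rise (suc u) e
    noRise-u (pair i j i<j (a<b , b<u)) = noRise s (pair i j i<j (a<b , <-trans b<u (s<s u<m)))
    zero-entry : Some (λ a → a ≡ 0 × suc u ≡ suc u) e
    zero-entry with some i p ← hasZero s = some i (p , refl)
    larger-entry : Some (λ a → suc u < a × suc u ≡ suc u) e
    larger-entry with some i p ← hasLast s = some i (subst (suc u <_) (sym p) (s<s u<m) , refl)
    zer-ok : ∀ zer → ZeroAllowed zer e → ZeroAllowed zer (e ∷ʳ suc u)
    zer-ok true h = Pair-no h λ ()
    zer-ok false h = Pair-old h

  reject-zero : ∀ {rep} → Ends e m rep false → ¬ Avoids 100-012 (e ∷ʳ 0)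
  reject-zero s av = proj₁ (proj₂ (to (Avoids-∷ʳ e 0) av)) (zeroAllowed s)

  reject-repeated : ∀ {zer} → Ends e m false zer → ¬ Avoids 100-012 (e ∷ʳ suc m)
  reject-repeated s av = proj₁ (proj₂ (to (Avoids-∷ʳ e _) av)) (repeatable s)

  reject-larger : ∀ {rep zer x} → suc m < x → Ends e m rep zer → ¬ Avoids 100-012 (e ∷ʳ x)
  reject-larger {x = x} m<x s av = proj₂ (proj₂ (to (Avoids-∷ʳ e x) av)) rise
    where
    rise : Rise x e
    rise with pair i j i<j (p , q) ← ascent s =
      pair i j i<j (subst₂ _<_ (sym p) (sym q) z<s , subst (_< x) (sym q) m<x)

-- e consists of zeros. Avoidance is a consequence, recorded for convenience.
record AllZero {n} (e : Vec ℕ n) : Set where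
  field
    allZero : ∀ i → lookup e i ≡ 0
    avoids  : Avoids 100-012 e

module _ {n : ℕ} {e : Vec ℕ n} (z : AllZero e) where
  open AllZero z renaming (avoids to avoids-e)

  private
    ¬Some : ∀ {P : ℕ → Set} → ¬ P 0 → ¬ Some P e
    ¬Some {P} ¬p (some i p) = ¬p (subst P (allZero i) p)

    ¬Drop : ∀ {y} → ¬ Drop y e
    ¬Drop {y} (pair i _ _ (y<a , _)) = ¬Some {y <_} n≮0 (some i y<a)

    ¬Rise : ∀ {y} → ¬ Rise y e
    ¬Rise (pair i j _ (a<b , _)) = ¬Some {lookup e i <_} n≮0 (some j a<b)

  AllZero-append-zero : AllZero (e ∷ʳ 0)
  AllZero-append-zero = record
    { allZero = λ i → at (last? i)
    ; avoids = from (Avoids-∷ʳ e 0) (avoids-e , ¬Drop , ¬Rise)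
    }
    where
    at : ∀ {i} → Last i → lookup (e ∷ʳ 0) i ≡ 0
    at (inner i) = trans (lookup-∷ʳ-inject₁ e 0 i) (allZero i)
    at last = lookup-∷ʳ-fromℕ e 0

  AllZero-append-positive : ∀ {m} → m < n → Ends (e ∷ʳ suc m) m true true
  AllZero-append-positive {m} m<n = record
    { inRange = m<n⇒m<1+n m<n
    ; avoids = from (Avoids-∷ʳ e _) (avoids-e , ¬Drop , ¬Rise)
    ; ascent = from (Pair-∷ʳ e _) (inj₂ (some-entry m<n allZero))
    ; noRise = [ ¬Rise , (λ (some _ (_ , lt)) → <-irrefl refl lt) ]′ ∘ to (Pair-∷ʳ e _)
    ; noDrop = λ u u<m →
        [ ¬Drop , (λ (some _ (_ , eq)) → >⇒≢ u<m (suc-injective eq)) ]′ ∘ to (Pair-∷ʳ e _)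
    ; repeatable = [ ¬Some n≮0 , <-irrefl refl ]′ ∘ to (Some-∷ʳ e _)
    ; zeroAllowed = [ ¬Drop , (λ ()) ]′ ∘ to (Pair-∷ʳ e _)
    }
    where
    some-entry : ∀ {k} {w : Vec ℕ k} → m < k → (∀ i → lookup w i ≡ 0) →
      Some (λ a → a ≡ 0 × suc m ≡ suc m) w
    some-entry {suc _} _ h = some zero (h zero , refl)

------------------------------------------------------------------------
-- Finite sums

∑-last : ∀ f n → ∑ f (suc n) ≡ ∑ f n + f n
∑-last f zero = +-comm (f 0) 0
∑-last f (suc n) = trans (cong (λ z → f 0 + z) (∑-last (f ∘ suc) n)) (sym (+-assoc (f 0) _ _))

∑-truncate : ∀ {f m n} → m < n → (∀ x → m < x → f x ≡ 0) → ∑ f n ≡ ∑ f m + f m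
∑-truncate {f} {zero} {suc n} _ h =
  trans (cong (λ z → f 0 + z) (∑-zero n λ x _ → h (suc x) z<s)) (+-identityʳ (f 0))
∑-truncate {f} {suc m} {suc n} m<n h =
  trans (cong (λ z → f 0 + z) (∑-truncate (s<s⁻¹ m<n) λ x m<x → h (suc x) (s<s m<x)))
        (sym (+-assoc (f 0) _ _))

∑-+ : ∀ f g n → ∑ (λ x → f x + g x) n ≡ ∑ f n + ∑ g n
∑-+ f g zero = refl
∑-+ f g (suc n) = trans (cong (λ z → f 0 + g 0 + z) (∑-+ (f ∘ suc) (g ∘ suc) n))
  (interchange (f 0) (g 0) _ _)
  where
  interchange : ∀ a b c d → a + b + (c + d) ≡ (a + c) + (b + d)
  interchange = solve-∀

∑-* : ∀ k f n → ∑ (λ x → k * f x) n ≡ k * ∑ f n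
∑-* k f zero = sym (*-zeroʳ k)
∑-* k f (suc n) = trans (cong (λ z → k * f 0 + z) (∑-* k (f ∘ suc) n)) (sym (*-distribˡ-+ k (f 0) _))

∑-C : ∀ m r → ∑ (_C r) m ≡ m C suc r
∑-C zero r = refl
∑-C (suc m) r = begin
  ∑ (_C r) (suc m)    ≡⟨ ∑-last (_C r) m ⟩
  ∑ (_C r) m + m C r  ≡⟨ cong (_+ m C r) (∑-C m r) ⟩
  m C suc r + m C r   ≡⟨ +-comm (m C suc r) _ ⟩
  m C r + m C suc r   ≡⟨ nCk+nC[k+1]≡[n+1]C[k+1] m r ⟩
  suc m C suc r       ∎
  where open ≡-Reasoning

------------------------------------------------------------------------
-- The number of ways to complete a prefix

-- The number of words of r positive letters that may follow the last nonzero letter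
-- m + 1, the flag telling whether that letter may be repeated.
-- If that letter is not repeatable these are the strictly decreasing words with
-- letters in 1, …, m; otherwise they are such words preceded by copies of m + 1.
positiveTails : Bool → ℕ → ℕ → ℕ
positiveTails false m r = m C r
positiveTails true m zero = 1
positiveTails true m (suc r) = m C suc r + positiveTails true m r

-- If f r counts words of r positive letters, then this counts the words of r
-- letters with at most one 0 in any of the r positions.
withZero : (ℕ → ℕ) → ℕ → ℕ
withZero f zero = f zero
withZero f (suc r) = f (suc r) + suc r * f r

-- The number of words of r letters that may follow a word in the state Ends e m rep zer.
tails : Bool → Bool → ℕ → ℕ → ℕ
tails rep false m = positiveTails rep m
tails rep true m = withZero (positiveTails rep m)

-- k if the flag is set, and 0 otherwise.
optional : Bool → ℕ → ℕ
optional b k = if b then k else 0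

optional-linear : ∀ b x k y → optional b (x + k * y) ≡ optional b x + k * optional b y
optional-linear true x k y = refl
optional-linear false x k y = sym (*-zeroʳ k)

positiveTails-suc : ∀ rep m r → positiveTails rep m (suc r) ≡
  ∑ (λ u → positiveTails false u r) m + optional rep (positiveTails rep m r)
positiveTails-suc true m r = cong (_+ positiveTails true m r) (sym (∑-C m r))
positiveTails-suc false m r = trans (sym (∑-C m r)) (sym (+-identityʳ _))

-- The summands correspond to the next letter being 0, being positive and smaller
-- than m + 1, or being m + 1.
tails-suc : ∀ rep zer m r → tails rep zer m (suc r) ≡
  optional zer (tails rep false m r) +
  (∑ (λ u → tails false zer u r) m + optional rep (tails rep zer m r))
tails-suc rep false m r = positiveTails-suc rep m r
tails-suc rep true m zero = begin
  positiveTails rep m 1 + 1 * positiveTails rep m 0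
    ≡⟨ cong (_+ 1 * positiveTails rep m 0) (positiveTails-suc rep m 0) ⟩
  ∑ (λ u → positiveTails false u 0) m + optional rep (positiveTails rep m 0) + 1 * positiveTails rep m 0
    ≡⟨ swap (∑ (λ u → positiveTails false u 0) m + optional rep (positiveTails rep m 0)) _ ⟩
  positiveTails rep m 0 + (∑ (λ u → positiveTails false u 0) m + optional rep (positiveTails rep m 0)) ∎
  where
  open ≡-Reasoning
  swap : ∀ x y → x + 1 * y ≡ y + x
  swap = solve-∀
tails-suc rep true m (suc r) = begin
  w (2 + r) + (2 + r) * w (1 + r)
    ≡⟨ expand (w (2 + r)) (1 + r) (w (1 + r)) ⟩
  w (1 + r) + (w (2 + r) + (1 + r) * w (1 + r))
    ≡⟨ cong₂ (λ x y → w (1 + r) + (x + (1 + r) * y))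
         (positiveTails-suc rep m (1 + r)) (positiveTails-suc rep m r) ⟩
  w (1 + r) + (∑ (v (1 + r)) m + o (1 + r) + (1 + r) * (∑ (v r) m + o r))
    ≡⟨ cong (λ z → w (1 + r) + z) (regroup (∑ (v (1 + r)) m) (o (1 + r)) (1 + r) (∑ (v r) m) (o r)) ⟩
  w (1 + r) + ((∑ (v (1 + r)) m + (1 + r) * ∑ (v r) m) + (o (1 + r) + (1 + r) * o r))
    ≡⟨ cong₂ (λ x y → w (1 + r) + (x + y))
         (sym sums) (sym (optional-linear rep (w (1 + r)) (1 + r) (w r))) ⟩
  w (1 + r) + (∑ (λ u → v (1 + r) u + (1 + r) * v r u) m + optional rep (w (1 + r) + (1 + r) * w r)) ∎
  where
  open ≡-Reasoning
  w : ℕ → ℕ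
  w = positiveTails rep m
  v : ℕ → ℕ → ℕ
  v r u = positiveTails false u r
  o : ℕ → ℕ
  o r = optional rep (w r)
  expand : ∀ x k y → x + (1 + k) * y ≡ y + (x + k * y)
  expand = solve-∀
  regroup : ∀ a b k c d → a + b + k * (c + d) ≡ (a + k * c) + (b + k * d)
  regroup = solve-∀
  sums : ∑ (λ u → v (1 + r) u + (1 + r) * v r u) m ≡ ∑ (v (1 + r)) m + (1 + r) * ∑ (v r) m
  sums = trans (∑-+ (v (1 + r)) (λ u → (1 + r) * v r u) m)
               (cong (λ z → ∑ (v (1 + r)) m + z) (∑-* (1 + r) (v r) m))

tails-zero : ∀ rep zer m → tails rep zer m 0 ≡ 1
tails-zero true true m = refl
tails-zero true false m = refl
tails-zero false true m = refl
tails-zero false false m = refl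

-- The bound on a letter by its position imposes no restriction here, because the
-- letters up to m + 1 are below all later positions (inRange).
completions-Ends : ∀ {n m rep zer} {e : Vec ℕ n} r → Ends e m rep zer →
  completions 100-012 e r ≡ tails rep zer m r
completions-Ends {m = m} {rep} {zer} {e} zero s =
  trans (completions-avoiding 100-012 e (avoids s)) (sym (tails-zero rep zer m))
completions-Ends {n} {m} {rep} {zer} {e} (suc r) s = begin
  f 0 + ∑ (f ∘ suc) n
    -- Only the letters up to m + 1 contribute.
    ≡⟨ cong (λ z → f 0 + z) (∑-truncate (inRange s) λ x m<x →
         completions-containing (e ∷ʳ suc x) r (reject-larger (s<s m<x) s)) ⟩
  f 0 + (∑ (f ∘ suc) m + f (suc m))
    ≡⟨ cong₂ _+_ (zero-next zer s) (cong₂ _+_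
         (∑-cong m λ u u<m → completions-Ends r (append-smaller u<m s)) (repeat-next rep s)) ⟩
  optional zer (tails rep false m r) +
  (∑ (λ u → tails false zer u r) m + optional rep (tails rep zer m r))
    ≡⟨ tails-suc rep zer m r ⟨
  tails rep zer m (suc r) ∎
  where
  open ≡-Reasoning
  f : ℕ → ℕ
  f x = completions 100-012 (e ∷ʳ x) r
  zero-next : ∀ zer → Ends e m rep zer → f 0 ≡ optional zer (tails rep false m r)
  zero-next true s = completions-Ends r (append-zero s)
  zero-next false s = completions-containing (e ∷ʳ 0) r (reject-zero s)
  repeat-next : ∀ rep → Ends e m rep zer → f (suc m) ≡ optional rep (tails rep zer m r)
  repeat-next true s = completions-Ends r (append-repeated s)
  repeat-next false s = completions-containing (e ∷ʳ suc m) r (reject-repeated s)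

-- The number of completions of n zeros by r letters: the next letter is 0 or m + 1
-- for some m < n.
zeroTails : ℕ → ℕ → ℕ
zeroTails n zero = 1
zeroTails n (suc r) = zeroTails (suc n) r + ∑ (λ m → tails true true m r) n

completions-AllZero : ∀ {n} {e : Vec ℕ n} r → AllZero e → completions 100-012 e r ≡ zeroTails n r
completions-AllZero {e = e} zero z = completions-avoiding 100-012 e (AllZero.avoids z)
completions-AllZero {n} (suc r) z = cong₂ _+_
  (completions-AllZero r (AllZero-append-zero z))
  (∑-cong n λ m m<n → completions-Ends r (AllZero-append-positive z m<n))

-- The number of avoiding inversion sequences with n letters.
T : ℕ → ℕ
T = zeroTails 0

∣I∣≡T : ∀ n → ∣I∣ n 100-012 ≡ T (suc n)
∣I∣≡T n = trans (∣I∣≡completions n 100-012) (completions-AllZero (suc n) empty)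
  where
  empty : AllZero []
  empty = record { allZero = λ () ; avoids = (λ { (() ∷ _ , _) }) ∷ (λ { (() ∷ _ , _) }) ∷ [] }

------------------------------------------------------------------------
-- Diagonal sums

-- f n (r - 1) + f (n + 1) (r - 2) + ⋯ + f (n + r - 1) 0
diagonal : (ℕ → ℕ → ℕ) → ℕ → ℕ → ℕ
diagonal f n zero = 0
diagonal f n (suc r) = f n r + diagonal f (suc n) r

-- An extra 0 at the front turns completions of n zeros into completions of n + 1
-- zeros. The completions missed are those whose first nonzero letter is equal to its
-- position.
zeroTails-suc : ∀ n r → zeroTails (suc n) r ≡ zeroTails n r + diagonal (tails true true) n r
zeroTails-suc n zero = refl
zeroTails-suc n (suc r) = begin
  zeroTails (2 + n) r + ∑ p (suc n)
    ≡⟨ cong₂ _+_ (zeroTails-suc (suc n) r) (∑-last p n) ⟩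
  zeroTails (1 + n) r + diagonal (tails true true) (suc n) r + (∑ p n + p n)
    ≡⟨ regroup (zeroTails (1 + n) r) _ (∑ p n) (p n) ⟩
  zeroTails (1 + n) r + ∑ p n + (p n + diagonal (tails true true) (suc n) r) ∎
  where
  open ≡-Reasoning
  p : ℕ → ℕ
  p m = tails true true m r
  regroup : ∀ a b c d → a + b + (c + d) ≡ a + c + (d + b)
  regroup = solve-∀

-- The number of avoiding inversion sequences with n + 1 letters whose first nonzero
-- letter is equal to its position.
U : ℕ → ℕ
U = diagonal (tails true true) 0

T-suc : ∀ n → T (suc n) ≡ T n + U n
T-suc n = trans (+-identityʳ _) (zeroTails-suc 0 n)

-- A Pascal-type rule for f, with inhomogeneity g, sums to a Fibonacci-type rule.
diagonal-pascal : ∀ {f g} → (∀ m → f (suc m) 0 ≡ f m 0) →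
  (∀ m r → f (suc m) (suc r) ≡ f m (suc r) + f m r + g m r) →
  ∀ m r → diagonal f (suc m) (suc r) ≡ diagonal f m (suc r) + diagonal f m r + diagonal g m r
diagonal-pascal {f} {g} base step m zero = begin
  f (suc m) 0 + 0      ≡⟨ cong (_+ 0) (base m) ⟩
  f m 0 + 0            ≡⟨ pad (f m 0) ⟩
  f m 0 + 0 + 0 + 0    ∎
  where
  open ≡-Reasoning
  pad : ∀ x → x + 0 ≡ x + 0 + 0 + 0
  pad = solve-∀
diagonal-pascal {f} {g} base step m (suc r) = begin
  f (suc m) (suc r) + diagonal f (2 + m) (suc r)
    ≡⟨ cong₂ _+_ (step m r) (diagonal-pascal {f} {g} base step (suc m) r) ⟩
  f m (suc r) + f m r + g m r + (diagonal f (suc m) (suc r) + diagonal f (suc m) r + diagonal g (suc m) r)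
    ≡⟨ regroup (f m (suc r)) (f m r) (g m r) _ _ _ ⟩
  f m (suc r) + diagonal f (suc m) (suc r) + (f m r + diagonal f (suc m) r) + (g m r + diagonal g (suc m) r) ∎
  where
  open ≡-Reasoning
  regroup : ∀ a b c x y z → a + b + c + (x + y + z) ≡ a + x + (b + y) + (c + z)
  regroup = solve-∀

diagonal-zero : ∀ m r → diagonal (λ _ _ → 0) m r ≡ 0
diagonal-zero m zero = refl
diagonal-zero m (suc r) = diagonal-zero (suc m) r

-- The partial sum m C 0 + ⋯ + m C r.
S : ℕ → ℕ → ℕ
S = positiveTails true

S-pascal : ∀ m r → S (suc m) (suc r) ≡ S m (suc r) + S m r
S-pascal m zero = trans (cong (_+ 1) (sym (nCk+nC[k+1]≡[n+1]C[k+1] m 0))) (regroup (m C 1))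
  where
  regroup : ∀ x → 1 + x + 1 ≡ x + 1 + 1
  regroup = solve-∀
S-pascal m (suc r) = begin
  suc m C suc (suc r) + S (suc m) (suc r)
    ≡⟨ cong₂ _+_ (sym (nCk+nC[k+1]≡[n+1]C[k+1] m (suc r))) (S-pascal m r) ⟩
  m C suc r + m C suc (suc r) + (S m (suc r) + S m r)
    ≡⟨ regroup (m C suc r) (m C suc (suc r)) (S m (suc r)) (S m r) ⟩
  m C suc (suc r) + S m (suc r) + (m C suc r + S m r) ∎
  where
  open ≡-Reasoning
  regroup : ∀ a b c d → a + b + (c + d) ≡ b + c + (a + d)
  regroup = solve-∀

S-zeroˡ : ∀ r → S 0 r ≡ 1
S-zeroˡ zero = refl
S-zeroˡ (suc r) = S-zeroˡ r

diagonal-S : ∀ k → suc (diagonal S 0 k) ≡ Fib (2 + k)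
diagonal-S 0 = refl
diagonal-S 1 = refl
diagonal-S (suc (suc k)) = begin
  suc (S 0 (suc k) + diagonal S 1 (suc k))
    ≡⟨ cong suc (cong₂ _+_ (S-zeroˡ (suc k)) (diagonal-pascal {S} {λ _ _ → 0} (λ _ → refl)
         (λ m r → trans (S-pascal m r) (sym (+-identityʳ _))) 0 k)) ⟩
  suc (1 + (diagonal S 0 (suc k) + diagonal S 0 k + diagonal (λ _ _ → 0) 0 k))
    ≡⟨ cong (λ z → suc (1 + (diagonal S 0 (suc k) + diagonal S 0 k + z))) (diagonal-zero 0 k) ⟩
  suc (1 + (diagonal S 0 (suc k) + diagonal S 0 k + 0))
    ≡⟨ regroup (diagonal S 0 (suc k)) (diagonal S 0 k) ⟩
  suc (diagonal S 0 (suc k)) + suc (diagonal S 0 k)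
    ≡⟨ cong₂ _+_ (diagonal-S (suc k)) (diagonal-S k) ⟩
  Fib (3 + k) + Fib (2 + k) ∎
  where
  open ≡-Reasoning
  regroup : ∀ a b → suc (1 + (a + b + 0)) ≡ suc a + suc b
  regroup = solve-∀

-- S m (r - 1), with value 0 at r = 0.
S⁻ : ℕ → ℕ → ℕ
S⁻ m zero = 0
S⁻ m (suc r) = S m r

diagonal-S⁻ : ∀ m r → diagonal S⁻ m (suc r) ≡ diagonal S m r
diagonal-S⁻ m zero = refl
diagonal-S⁻ m (suc r) = cong (λ z → S m r + z) (diagonal-S⁻ (suc m) r)

suc-diagonal-S⁻ : ∀ k → suc (diagonal S⁻ 0 k) ≡ Fib (suc k)
suc-diagonal-S⁻ zero = refl
suc-diagonal-S⁻ (suc k) = trans (cong suc (diagonal-S⁻ 0 k)) (diagonal-S k)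

tails-pascal : ∀ m r → tails true true (suc m) (suc r) ≡
  tails true true m (suc r) + tails true true m r + S⁻ m r
tails-pascal m zero = trans (cong (_+ 1) (S-pascal m 0)) (regroup (S m 1))
  where
  regroup : ∀ x → x + 1 + 1 ≡ x + 1 * 1 + 1 + 0
  regroup = solve-∀
tails-pascal m (suc r) = begin
  S (suc m) (2 + r) + (2 + r) * S (suc m) (1 + r)
    ≡⟨ cong₂ (λ x y → x + (2 + r) * y) (S-pascal m (1 + r)) (S-pascal m r) ⟩
  S m (2 + r) + S m (1 + r) + (2 + r) * (S m (1 + r) + S m r)
    ≡⟨ regroup (S m (2 + r)) (S m (1 + r)) (S m r) r ⟩
  S m (2 + r) + (2 + r) * S m (1 + r) + (S m (1 + r) + (1 + r) * S m r) + S m r ∎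
  where
  open ≡-Reasoning
  regroup : ∀ a b c r → a + b + (2 + r) * (b + c) ≡ a + (2 + r) * b + (b + (1 + r) * c) + c
  regroup = solve-∀

U-suc-suc : ∀ k → U (2 + k) ≡ suc k + Fib (suc k) + U (suc k) + U k
U-suc-suc k = begin
  tails true true 0 (suc k) + diagonal (tails true true) 1 (suc k)
    ≡⟨ cong₂ _+_ (cong₂ (λ x y → x + suc k * y) (S-zeroˡ (suc k)) (S-zeroˡ k))
         (diagonal-pascal {tails true true} {S⁻} (λ _ → refl) tails-pascal 0 k) ⟩
  1 + suc k * 1 + (U (suc k) + U k + diagonal S⁻ 0 k)
    ≡⟨ regroup k (U (suc k)) (U k) (diagonal S⁻ 0 k) ⟩
  suc k + suc (diagonal S⁻ 0 k) + U (suc k) + U k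
    ≡⟨ cong (λ x → suc k + x + U (suc k) + U k) (suc-diagonal-S⁻ k) ⟩
  suc k + Fib (suc k) + U (suc k) + U k ∎
  where
  open ≡-Reasoning
  regroup : ∀ k a b c → 1 + suc k * 1 + (a + b + c) ≡ suc k + suc c + a + b
  regroup = solve-∀

------------------------------------------------------------------------
-- Closed forms

-- Written without subtraction. Solved for U m, it reads
-- 5 U m = (2 m + 10) Fib (m + 1) + (9 - m) Fib m - 5 (m + 2).
U-closed : ∀ m → 5 * U m + 5 * (m + 2) + m * Fib m ≡ (2 * m + 10) * Fib (suc m) + 9 * Fib m
U-closed 0 = refl
U-closed 1 = refl
U-closed (suc (suc m)) = begin
  5 * U (2 + m) + 5 * ((2 + m) + 2) + (2 + m) * (b + a)
    ≡⟨ cong (λ x → 5 * x + 5 * ((2 + m) + 2) + (2 + m) * (b + a)) (U-suc-suc m) ⟩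
  5 * (suc m + b + U (suc m) + U m) + 5 * ((2 + m) + 2) + (2 + m) * (b + a)
    ≡⟨ left m a b (U m) (U (suc m)) ⟩
  (5 * U (suc m) + 5 * (suc m + 2) + suc m * b) + (5 * U m + 5 * (m + 2) + m * a) + (6 * b + 2 * a)
    ≡⟨ cong₂ (λ x y → x + y + (6 * b + 2 * a)) (U-closed (suc m)) (U-closed m) ⟩
  ((2 * suc m + 10) * (b + a) + 9 * b) + ((2 * m + 10) * b + 9 * a) + (6 * b + 2 * a)
    ≡⟨ right m a b ⟩
  (2 * (2 + m) + 10) * (b + a + b) + 9 * (b + a) ∎
  where
  open ≡-Reasoning
  a b : ℕ
  a = Fib m
  b = Fib (suc m)
  left : ∀ m a b u v → 5 * (suc m + b + v + u) + 5 * ((2 + m) + 2) + (2 + m) * (b + a) ≡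
    (5 * v + 5 * (suc m + 2) + suc m * b) + (5 * u + 5 * (m + 2) + m * a) + (6 * b + 2 * a)
  left = solve-∀
  right : ∀ m a b → ((2 * suc m + 10) * (b + a) + 9 * b) + ((2 * m + 10) * b + 9 * a) + (6 * b + 2 * a) ≡
    (2 * (2 + m) + 10) * (b + a + b) + 9 * (b + a)
  right = solve-∀

[m+3]C2 : ∀ m → suc (m + 2) C 2 ≡ (m + 2) + (m + 2) C 2
[m+3]C2 m = trans (sym (nCk+nC[k+1]≡[n+1]C[k+1] (m + 2) 1)) (cong (_+ (m + 2) C 2) (nC1≡n (m + 2)))

T-closed′ : ∀ m → 5 * (T m + 1 + (m + 2) C 2) ≡
  (m + 7) * Fib m + 15 * Fib (suc m) + m * Fib (2 + m)
T-closed′ zero = refl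
-- Adding m * a to both sides avoids the subtraction in the formula for U m.
T-closed′ (suc m) = +-cancelʳ-≡ (m * a) _ _ (begin
  5 * (T (suc m) + 1 + suc (m + 2) C 2) + m * a
    ≡⟨ cong₂ (λ x y → 5 * (x + 1 + y) + m * a) (T-suc m) ([m+3]C2 m) ⟩
  5 * (T m + U m + 1 + ((m + 2) + (m + 2) C 2)) + m * a
    ≡⟨ left m (T m) (U m) ((m + 2) C 2) a ⟩
  5 * (T m + 1 + (m + 2) C 2) + (5 * U m + 5 * (m + 2) + m * a)
    ≡⟨ cong₂ _+_ (T-closed′ m) (U-closed m) ⟩
  (m + 7) * a + 15 * b + m * (b + a) + ((2 * m + 10) * b + 9 * a)
    ≡⟨ right m a b ⟩
  (suc m + 7) * b + 15 * (b + a) + suc m * (b + a + b) + m * a ∎)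
  where
  open ≡-Reasoning
  a b : ℕ
  a = Fib m
  b = Fib (suc m)
  left : ∀ m t u c a → 5 * (t + u + 1 + ((m + 2) + c)) + m * a ≡
    5 * (t + 1 + c) + (5 * u + 5 * (m + 2) + m * a)
  left = solve-∀
  right : ∀ m a b → (m + 7) * a + 15 * b + m * (b + a) + ((2 * m + 10) * b + 9 * a) ≡
    (suc m + 7) * b + 15 * (b + a) + suc m * (b + a + b) + m * a
  right = solve-∀

T-closed : ∀ m → 5 * (T m + 1 + (m + 2) C 2) ≡
  (m + 7) * Fib m + 15 * Fib (m + 1) + m * Fib (m + 2)
T-closed m rewrite +-comm m 1 | +-comm m 2 = trans
  (cong (λ k → 5 * (T m + 1 + k C 2)) (+-comm 2 m)) (T-closed′ m)

------------------------------------------------------------------------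
-- The multiplicative monoid of power series

-- Division by X after removal of the constant term. The coefficient (f ⊛ g) (suc n)
-- unfolds to f 0 * g (suc n) + (shift f ⊛ g) n, which makes induction on n possible.
shift : Series → Series
shift f n = f (suc n)

-- Scalar multiplication.
_·_ : ℤ → Series → Series
(c · f) n = c ℤ.* f n

-- Coefficientwise equality as a record, from which the two series can be inferred.
infix 4 _≋_
record _≋_ (f g : Series) : Set where
  constructor coefficientwise
  field
    coefficients : f ≈ g

open _≋_

≋-refl : ∀ {f} → f ≋ f
≋-refl = coefficientwise λ _ → refl

⊛-cong : ∀ {f f′ g g′} → f ≋ f′ → g ≋ g′ → f ⊛ g ≋ f′ ⊛ g′
⊛-cong p q = coefficientwise (cong-at (coefficients p) (coefficients q))
  where
  cong-at : ∀ {f f′ g g′} → f ≈ f′ → g ≈ g′ → f ⊛ g ≈ f′ ⊛ g′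
  cong-at p q zero = cong (ℤ._+ 0ℤ) (cong₂ ℤ._*_ (p 0) (q 0))
  cong-at {f} {f′} {g} {g′} p q (suc n) =
    cong₂ ℤ._+_ (cong₂ ℤ._*_ (p 0) (q (suc n))) (cong-at {shift f} {shift f′} {g} {g′} (p ∘ suc) q n)

⊛-distribʳ : ∀ f g h → (f ⊕ g) ⊛ h ≈ f ⊛ h ⊕ g ⊛ h
⊛-distribʳ f g h zero = distrib (f 0) (g 0) (h 0)
  where
  distrib : ∀ a b c → (a ℤ.+ b) ℤ.* c ℤ.+ 0ℤ ≡ (a ℤ.* c ℤ.+ 0ℤ) ℤ.+ (b ℤ.* c ℤ.+ 0ℤ)
  distrib = ℤ.solve-∀
⊛-distribʳ f g h (suc n) = trans
  (cong (λ z → (f 0 ℤ.+ g 0) ℤ.* h (suc n) ℤ.+ z) (⊛-distribʳ (shift f) (shift g) h n))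
  (regroup (f 0) (g 0) (h (suc n)) _ _)
  where
  regroup : ∀ a b c x y → (a ℤ.+ b) ℤ.* c ℤ.+ (x ℤ.+ y) ≡ (a ℤ.* c ℤ.+ x) ℤ.+ (b ℤ.* c ℤ.+ y)
  regroup = ℤ.solve-∀

⊛-scaleˡ : ∀ c f g → (c · f) ⊛ g ≈ c · (f ⊛ g)
⊛-scaleˡ c f g zero = regroup c (f 0) (g 0)
  where
  regroup : ∀ c a b → c ℤ.* a ℤ.* b ℤ.+ 0ℤ ≡ c ℤ.* (a ℤ.* b ℤ.+ 0ℤ)
  regroup = ℤ.solve-∀
⊛-scaleˡ c f g (suc n) = trans
  (cong (λ z → c ℤ.* f 0 ℤ.* g (suc n) ℤ.+ z) (⊛-scaleˡ c (shift f) g n))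
  (regroup c (f 0) (g (suc n)) _)
  where
  regroup : ∀ c a b x → c ℤ.* a ℤ.* b ℤ.+ c ℤ.* x ≡ c ℤ.* (a ℤ.* b ℤ.+ x)
  regroup = ℤ.solve-∀

-- The mirror image of the unfolding of (f ⊛ g) (suc n).
⊛-sucʳ : ∀ f g n → (f ⊛ g) (suc n) ≡ f (suc n) ℤ.* g 0 ℤ.+ (f ⊛ shift g) n
⊛-sucʳ f g zero = regroup (f 0 ℤ.* g 1) (f 1 ℤ.* g 0)
  where
  regroup : ∀ x y → x ℤ.+ (y ℤ.+ 0ℤ) ≡ y ℤ.+ (x ℤ.+ 0ℤ)
  regroup = ℤ.solve-∀
⊛-sucʳ f g (suc n) = trans
  (cong (λ z → f 0 ℤ.* g (2 + n) ℤ.+ z) (⊛-sucʳ (shift f) g n))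
  (regroup (f 0 ℤ.* g (2 + n)) (f (2 + n) ℤ.* g 0) _)
  where
  regroup : ∀ x y z → x ℤ.+ (y ℤ.+ z) ≡ y ℤ.+ (x ℤ.+ z)
  regroup = ℤ.solve-∀

⊛-comm : ∀ f g → f ⊛ g ≈ g ⊛ f
⊛-comm f g zero = cong (ℤ._+ 0ℤ) (ℤ.*-comm (f 0) (g 0))
⊛-comm f g (suc n) = trans
  (cong₂ ℤ._+_ (ℤ.*-comm (f 0) (g (suc n))) (⊛-comm (shift f) g n))
  (sym (⊛-sucʳ g f n))

⊛-assoc : ∀ f g h → (f ⊛ g) ⊛ h ≈ f ⊛ (g ⊛ h)
⊛-assoc f g h zero = regroup (f 0) (g 0) (h 0)
  where
  regroup : ∀ a b c → (a ℤ.* b ℤ.+ 0ℤ) ℤ.* c ℤ.+ 0ℤ ≡ a ℤ.* (b ℤ.* c ℤ.+ 0ℤ) ℤ.+ 0ℤ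
  regroup = ℤ.solve-∀
⊛-assoc f g h (suc n) = begin
  (f 0 ℤ.* g 0 ℤ.+ 0ℤ) ℤ.* h (suc n) ℤ.+ (((f 0 · shift g) ⊕ (shift f ⊛ g)) ⊛ h) n
    ≡⟨ cong (λ z → (f 0 ℤ.* g 0 ℤ.+ 0ℤ) ℤ.* h (suc n) ℤ.+ z) (⊛-distribʳ (f 0 · shift g) (shift f ⊛ g) h n) ⟩
  (f 0 ℤ.* g 0 ℤ.+ 0ℤ) ℤ.* h (suc n) ℤ.+ (((f 0 · shift g) ⊛ h) n ℤ.+ ((shift f ⊛ g) ⊛ h) n)
    ≡⟨ cong₂ (λ x y → (f 0 ℤ.* g 0 ℤ.+ 0ℤ) ℤ.* h (suc n) ℤ.+ (x ℤ.+ y))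
         (⊛-scaleˡ (f 0) (shift g) h n) (⊛-assoc (shift f) g h n) ⟩
  (f 0 ℤ.* g 0 ℤ.+ 0ℤ) ℤ.* h (suc n) ℤ.+ (f 0 ℤ.* (shift g ⊛ h) n ℤ.+ (shift f ⊛ (g ⊛ h)) n)
    ≡⟨ regroup (f 0) (g 0) (h (suc n)) _ _ ⟩
  f 0 ℤ.* (g 0 ℤ.* h (suc n) ℤ.+ (shift g ⊛ h) n) ℤ.+ (shift f ⊛ (g ⊛ h)) n ∎
  where
  open ≡-Reasoning
  regroup : ∀ a b c x y → (a ℤ.* b ℤ.+ 0ℤ) ℤ.* c ℤ.+ (a ℤ.* x ℤ.+ y) ≡ a ℤ.* (b ℤ.* c ℤ.+ x) ℤ.+ y
  regroup = ℤ.solve-∀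

⊛-zeroˡ : ∀ g → (λ _ → 0ℤ) ⊛ g ≈ (λ _ → 0ℤ)
⊛-zeroˡ g zero = refl
⊛-zeroˡ g (suc n) = trans (ℤ.+-identityˡ _) (⊛-zeroˡ g n)

const-⊛ : ∀ c g → const c ⊛ g ≈ c · g
const-⊛ c g zero = ℤ.+-identityʳ _
const-⊛ c g (suc n) = trans (cong (λ z → c ℤ.* g (suc n) ℤ.+ z) (⊛-zeroˡ g n)) (ℤ.+-identityʳ _)

⊛-identityˡ : ∀ g → const 1ℤ ⊛ g ≈ g
⊛-identityˡ g n = trans (const-⊛ 1ℤ g n) (ℤ.*-identityˡ (g n))

⊛-1-commutativeMonoid : CommutativeMonoid 0ℓ 0ℓ
⊛-1-commutativeMonoid = record
  { Carrier = Series
  ; _≈_ = _≋_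
  ; _∙_ = _⊛_
  ; ε = const 1ℤ
  ; isCommutativeMonoid = record
    { isMonoid = record
      { isSemigroup = record
        { isMagma = record
          { isEquivalence = record
            { refl = ≋-refl
            ; sym = λ p → coefficientwise λ n → sym (coefficients p n)
            ; trans = λ p q → coefficientwise λ n → trans (coefficients p n) (coefficients q n)
            }
          ; ∙-cong = ⊛-cong
          }
        ; assoc = λ f g h → coefficientwise (⊛-assoc f g h)
        }
      ; identity = (λ g → coefficientwise (⊛-identityˡ g))
                 , (λ g → coefficientwise λ n → trans (⊛-comm g (const 1ℤ) n) (⊛-identityˡ g n))
      }
    ; comm = λ f g → coefficientwise (⊛-comm f g)
    }
  }

module ⊛ = CommutativeMonoid ⊛-1-commutativeMonoid
open CommutativeMonoidSolver ⊛-1-commutativeMonoid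
  using (solve; _⊜_) renaming (_⊕_ to _:⊛_; id to :1)

-- If b is the inverse of a, then a g = f gives g = b f; the product a g may be given
-- in another form h.
divide : ∀ a b g {f h} → a ⊛ b ≋ const 1ℤ → a ⊛ g ≋ h → h ≋ f → g ≋ b ⊛ f
divide a b g {f} ab≈1 ag≈h h≈f = begin
  g              ≈⟨ ⊛.identityˡ g ⟨
  const 1ℤ ⊛ g   ≈⟨ ⊛.∙-congʳ {g} ab≈1 ⟨
  (a ⊛ b) ⊛ g    ≈⟨ ⊛.∙-congʳ {g} (⊛.comm a b) ⟩
  (b ⊛ a) ⊛ g    ≈⟨ ⊛.assoc b a g ⟩
  b ⊛ (a ⊛ g)    ≈⟨ ⊛.∙-congˡ {b} (⊛.trans ag≈h h≈f) ⟩
  b ⊛ f          ∎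
  where open import Relation.Binary.Reasoning.Setoid ⊛.setoid

------------------------------------------------------------------------
-- The factors of the denominator

1-X 1-X-X² : Series
1-X = const (+ 1) ⊖ X
1-X-X² = const (+ 1) ⊖ X ⊖ X ^ 2

X-⊛-suc : ∀ g n → (X ⊛ g) (suc n) ≡ g n
X-⊛-suc g n = begin
  0ℤ ℤ.+ (shift X ⊛ g) n  ≡⟨ ℤ.+-identityˡ _ ⟩
  (shift X ⊛ g) n         ≡⟨ coefficients (⊛.∙-congʳ {g} shift-X) n ⟩
  (const 1ℤ ⊛ g) n        ≡⟨ ⊛-identityˡ g n ⟩
  g n                     ∎
  where
  open ≡-Reasoning
  shift-X : shift X ≋ const 1ℤ
  coefficients shift-X zero = refl
  coefficients shift-X (suc _) = refl

-- Multiplication by 1 - X (for δ) and by 1 - X - X² (for φ), in terms of coefficients.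
δ φ : Series → Series
δ g zero = g 0
δ g (suc n) = g (suc n) ℤ.- g n
φ g zero = g 0
φ g (suc zero) = g 1 ℤ.- g 0
φ g (suc (suc n)) = g (2 + n) ℤ.- g (1 + n) ℤ.- g n

shift-1-X : shift 1-X ≋ const -[1+ 0 ]
coefficients shift-1-X zero = refl
coefficients shift-1-X (suc n) = refl

1-X-⊛ : ∀ g → 1-X ⊛ g ≋ δ g
coefficients (1-X-⊛ g) zero = trans (ℤ.+-identityʳ _) (ℤ.*-identityˡ (g 0))
coefficients (1-X-⊛ g) (suc n) = begin
  1ℤ ℤ.* g (suc n) ℤ.+ (shift 1-X ⊛ g) n
    ≡⟨ cong (λ z → 1ℤ ℤ.* g (suc n) ℤ.+ z)
         (trans (coefficients (⊛.∙-congʳ {g} shift-1-X) n) (const-⊛ -[1+ 0 ] g n)) ⟩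
  1ℤ ℤ.* g (suc n) ℤ.+ -[1+ 0 ] ℤ.* g n
    ≡⟨ regroup (g (suc n)) (g n) ⟩
  g (suc n) ℤ.- g n ∎
  where
  open ≡-Reasoning
  regroup : ∀ x y → 1ℤ ℤ.* x ℤ.+ -[1+ 0 ] ℤ.* y ≡ x ℤ.- y
  regroup = ℤ.solve-∀

shift²-1-X-X² : shift (shift 1-X-X²) ≋ const -[1+ 0 ]
coefficients shift²-1-X-X² zero = refl
coefficients shift²-1-X-X² (suc n) = cong (λ z → 0ℤ ℤ.- z)
  (trans (X-⊛-suc (X ^ 1) (2 + n)) (X-⊛-suc (X ^ 0) (1 + n)))

1-X-X²-⊛ : ∀ g → 1-X-X² ⊛ g ≋ φ g
coefficients (1-X-X²-⊛ g) zero = trans (ℤ.+-identityʳ _) (ℤ.*-identityˡ (g 0))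
coefficients (1-X-X²-⊛ g) (suc zero) = regroup (g 1) (g 0)
  where
  regroup : ∀ x y → 1ℤ ℤ.* x ℤ.+ (-[1+ 0 ] ℤ.* y ℤ.+ 0ℤ) ≡ x ℤ.- y
  regroup = ℤ.solve-∀
coefficients (1-X-X²-⊛ g) (suc (suc n)) = begin
  1ℤ ℤ.* g (2 + n) ℤ.+ (-[1+ 0 ] ℤ.* g (1 + n) ℤ.+ (shift (shift 1-X-X²) ⊛ g) n)
    ≡⟨ cong (λ x → 1ℤ ℤ.* g (2 + n) ℤ.+ (-[1+ 0 ] ℤ.* g (1 + n) ℤ.+ x))
         (trans (coefficients (⊛.∙-congʳ {g} shift²-1-X-X²) n) (const-⊛ -[1+ 0 ] g n)) ⟩
  1ℤ ℤ.* g (2 + n) ℤ.+ (-[1+ 0 ] ℤ.* g (1 + n) ℤ.+ -[1+ 0 ] ℤ.* g n)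
    ≡⟨ regroup (g (2 + n)) (g (1 + n)) (g n) ⟩
  g (2 + n) ℤ.- g (1 + n) ℤ.- g n ∎
  where
  open ≡-Reasoning
  regroup : ∀ x y z → 1ℤ ℤ.* x ℤ.+ (-[1+ 0 ] ℤ.* y ℤ.+ -[1+ 0 ] ℤ.* z) ≡ x ℤ.- y ℤ.- z
  regroup = ℤ.solve-∀

[1-X]⁻¹ [1-X-X²]⁻¹ : Series
[1-X]⁻¹ n = 1ℤ
[1-X-X²]⁻¹ n = + Fib (suc n)

1-X-inverse : 1-X ⊛ [1-X]⁻¹ ≋ const 1ℤ
1-X-inverse = coefficientwise λ n → trans (coefficients (1-X-⊛ [1-X]⁻¹) n) (ones n)
  where
  ones : δ [1-X]⁻¹ ≈ const 1ℤ
  ones zero = refl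
  ones (suc n) = refl

1-X-X²-inverse : 1-X-X² ⊛ [1-X-X²]⁻¹ ≋ const 1ℤ
1-X-X²-inverse = coefficientwise λ n → trans (coefficients (1-X-X²-⊛ [1-X-X²]⁻¹) n) (fib n)
  where
  cancel : ∀ x y → x ℤ.+ y ℤ.- x ℤ.- y ≡ 0ℤ
  cancel = ℤ.solve-∀
  fib : φ [1-X-X²]⁻¹ ≈ const 1ℤ
  fib 0 = refl
  fib 1 = refl
  fib (suc (suc n)) = trans
    (cong (λ x → x ℤ.- + Fib (2 + n) ℤ.- + Fib (1 + n)) (ℤ.pos-+ (Fib (2 + n)) (Fib (1 + n))))
    (cancel (+ Fib (2 + n)) (+ Fib (1 + n)))

------------------------------------------------------------------------
-- The generating function

R-suc : ∀ n → R (suc n) ≡ + T (suc n)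
R-suc n = cong +_ (∣I∣≡T n)

-- The coefficients of X ^ k, given by recursion.
monomial : ℕ → Series
monomial zero = const 1ℤ
monomial (suc k) zero = 0ℤ
monomial (suc k) (suc n) = monomial k n

X^-monomial : ∀ k → X ^ k ≈ monomial k
X^-monomial zero n = refl
X^-monomial (suc k) zero = refl
X^-monomial (suc k) (suc n) = trans (X-⊛-suc (X ^ k) n) (X^-monomial k n)

-- The second factor of the numerator.
P : Series
P = X ^ 6 ⊖ X ^ 5 ⊖ const (+ 3) ⊛ X ^ 4 ⊕ X ^ 3 ⊕ const (+ 3) ⊛ X ^ 2 ⊖ const (+ 3) ⊛ X ⊕ const (+ 1)

-- The successive products of R by 1 - X, 1 - X - X², 1 - X - X², 1 - X, 1 - X. The
-- coefficients eventually are U, then a linear part plus Fib; the second factor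
-- 1 - X - X² removes Fib, and the last two factors 1 - X remove the linear part. The
-- result R₅ is the numerator.
R₁ R₂ R₃ R₄ R₅ : Series
R₁ 0 = 0ℤ
R₁ 1 = 1ℤ
R₁ (suc (suc n)) = + U (suc n)
R₂ 0 = 0ℤ
R₂ 1 = 1ℤ
R₂ 2 = 0ℤ
R₂ 3 = 1ℤ
R₂ (suc (suc (suc (suc n)))) = + (2 + n) ℤ.+ + Fib (2 + n)
R₃ 0 = 0ℤ
R₃ 1 = 1ℤ
R₃ 2 = ℤ.- + 1
R₃ 3 = 0ℤ
R₃ 4 = + 2
R₃ 5 = 1ℤ
R₃ (suc (suc (suc (suc (suc (suc n)))))) = ℤ.- + suc n
R₄ 0 = 0ℤ
R₄ 1 = 1ℤ
R₄ 2 = ℤ.- + 2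
R₄ 3 = 1ℤ
R₄ 4 = + 2
R₄ 5 = ℤ.- + 1
R₄ 6 = ℤ.- + 2
R₄ (suc (suc (suc (suc (suc (suc (suc n))))))) = ℤ.- + 1
R₅ 1 = 1ℤ
R₅ 2 = ℤ.- + 3
R₅ 3 = + 3
R₅ 4 = 1ℤ
R₅ 5 = ℤ.- + 3
R₅ 6 = ℤ.- + 1
R₅ 7 = 1ℤ
R₅ _ = 0ℤ

δR : δ R ≋ R₁
coefficients δR 0 = refl
coefficients δR 1 = cong (ℤ._- 0ℤ) (R-suc 0)
coefficients δR (suc (suc n)) = begin
  R (2 + n) ℤ.- R (1 + n)
    ≡⟨ cong₂ ℤ._-_ (R-suc (suc n)) (R-suc n) ⟩
  + T (2 + n) ℤ.- + T (1 + n)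
    ≡⟨ cong (λ t → + t ℤ.- + T (1 + n)) (T-suc (suc n)) ⟩
  + (T (1 + n) + U (1 + n)) ℤ.- + T (1 + n)
    ≡⟨ cong (ℤ._- + T (1 + n)) (ℤ.pos-+ (T (1 + n)) (U (1 + n))) ⟩
  + T (1 + n) ℤ.+ + U (1 + n) ℤ.- + T (1 + n)
    ≡⟨ cancel (+ T (1 + n)) (+ U (1 + n)) ⟩
  + U (1 + n) ∎
  where
  open ≡-Reasoning
  cancel : ∀ x y → x ℤ.+ y ℤ.- x ≡ y
  cancel = ℤ.solve-∀

φR₁ : φ R₁ ≋ R₂
coefficients φR₁ 0 = refl
coefficients φR₁ 1 = refl
coefficients φR₁ 2 = refl
coefficients φR₁ 3 = refl
coefficients φR₁ (suc (suc (suc (suc n)))) = begin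
  + U (3 + n) ℤ.- + U (2 + n) ℤ.- + U (1 + n)
    ≡⟨ cong (λ x → + x ℤ.- + U (2 + n) ℤ.- + U (1 + n)) (U-suc-suc (suc n)) ⟩
  + (2 + n + Fib (2 + n) + U (2 + n) + U (1 + n)) ℤ.- + U (2 + n) ℤ.- + U (1 + n)
    ≡⟨ cong (λ x → x ℤ.- + U (2 + n) ℤ.- + U (1 + n)) (trans
         (ℤ.pos-+ (2 + n + Fib (2 + n) + U (2 + n)) (U (1 + n)))
         (cong (ℤ._+ + U (1 + n)) (ℤ.pos-+ (2 + n + Fib (2 + n)) (U (2 + n))))) ⟩
  + (2 + n + Fib (2 + n)) ℤ.+ + U (2 + n) ℤ.+ + U (1 + n) ℤ.- + U (2 + n) ℤ.- + U (1 + n)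
    ≡⟨ cancel (+ (2 + n + Fib (2 + n))) (+ U (2 + n)) (+ U (1 + n)) ⟩
  + (2 + n + Fib (2 + n))
    ≡⟨ ℤ.pos-+ (2 + n) (Fib (2 + n)) ⟩
  + (2 + n) ℤ.+ + Fib (2 + n) ∎
  where
  open ≡-Reasoning
  cancel : ∀ x y z → x ℤ.+ y ℤ.+ z ℤ.- y ℤ.- z ≡ x
  cancel = ℤ.solve-∀

φR₂ : φ R₂ ≋ R₃
coefficients φR₂ 0 = refl
coefficients φR₂ 1 = refl
coefficients φR₂ 2 = refl
coefficients φR₂ 3 = refl
coefficients φR₂ 4 = refl
coefficients φR₂ 5 = refl
coefficients φR₂ (suc (suc (suc (suc (suc (suc n)))))) = begin
  (+ (4 + n) ℤ.+ + Fib (4 + n)) ℤ.- (+ (3 + n) ℤ.+ + Fib (3 + n)) ℤ.- (+ (2 + n) ℤ.+ + Fib (2 + n))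
    ≡⟨ cong (λ x → (+ (4 + n) ℤ.+ x) ℤ.- (+ (3 + n) ℤ.+ + Fib (3 + n)) ℤ.- (+ (2 + n) ℤ.+ + Fib (2 + n)))
         (ℤ.pos-+ (Fib (3 + n)) (Fib (2 + n))) ⟩
  (+ (4 + n) ℤ.+ (+ Fib (3 + n) ℤ.+ + Fib (2 + n))) ℤ.- (+ (3 + n) ℤ.+ + Fib (3 + n)) ℤ.- (+ (2 + n) ℤ.+ + Fib (2 + n))
    ≡⟨ cancel (+ n) (+ Fib (3 + n)) (+ Fib (2 + n)) ⟩
  ℤ.- + suc n ∎
  where
  open ≡-Reasoning
  cancel : ∀ n x y →
    (+ 4 ℤ.+ n ℤ.+ (x ℤ.+ y)) ℤ.- (+ 3 ℤ.+ n ℤ.+ x) ℤ.- (+ 2 ℤ.+ n ℤ.+ y) ≡ ℤ.- (1ℤ ℤ.+ n)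
  cancel = ℤ.solve-∀

δR₃ : δ R₃ ≋ R₄
coefficients δR₃ 0 = refl
coefficients δR₃ 1 = refl
coefficients δR₃ 2 = refl
coefficients δR₃ 3 = refl
coefficients δR₃ 4 = refl
coefficients δR₃ 5 = refl
coefficients δR₃ 6 = refl
coefficients δR₃ (suc (suc (suc (suc (suc (suc (suc n))))))) = cancel (+ n)
  where
  cancel : ∀ n → ℤ.- (+ 2 ℤ.+ n) ℤ.- ℤ.- (1ℤ ℤ.+ n) ≡ ℤ.- + 1
  cancel = ℤ.solve-∀

δR₄ : δ R₄ ≋ R₅
coefficients δR₄ 0 = refl
coefficients δR₄ 1 = refl
coefficients δR₄ 2 = refl
coefficients δR₄ 3 = refl
coefficients δR₄ 4 = refl
coefficients δR₄ 5 = refl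
coefficients δR₄ 6 = refl
coefficients δR₄ 7 = refl
coefficients δR₄ (suc (suc (suc (suc (suc (suc (suc (suc n)))))))) = refl

X⊛P : X ⊛ P ≋ R₅
coefficients X⊛P zero = refl
coefficients X⊛P (suc n) = trans (X-⊛-suc P n) (trans P≡ (values n))
  where
  Q : Series
  Q n = monomial 6 n ℤ.- monomial 5 n ℤ.- + 3 ℤ.* monomial 4 n ℤ.+ monomial 3 n
    ℤ.+ + 3 ℤ.* monomial 2 n ℤ.- + 3 ℤ.* monomial 1 n ℤ.+ const (+ 1) n
  X-monomial : ∀ n → X n ≡ monomial 1 n
  X-monomial 0 = refl
  X-monomial 1 = refl
  X-monomial (suc (suc n)) = refl
  scaled : ∀ f {x} → f n ≡ x → (const (+ 3) ⊛ f) n ≡ + 3 ℤ.* x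
  scaled f p = trans (const-⊛ (+ 3) f n) (cong (+ 3 ℤ.*_) p)
  P≡ : P n ≡ Q n
  P≡ = cong₂ ℤ._+_ (cong₂ ℤ._-_ (cong₂ ℤ._+_ (cong₂ ℤ._+_ (cong₂ ℤ._-_ (cong₂ ℤ._-_
    (X^-monomial 6 n) (X^-monomial 5 n)) (scaled (X ^ 4) (X^-monomial 4 n))) (X^-monomial 3 n))
    (scaled (X ^ 2) (X^-monomial 2 n))) (scaled X (X-monomial n))) refl
  values : ∀ n → Q n ≡ R₅ (suc n)
  values 0 = refl
  values 1 = refl
  values 2 = refl
  values 3 = refl
  values 4 = refl
  values 5 = refl
  values 6 = refl
  values (suc (suc (suc (suc (suc (suc (suc n))))))) = refl

-- The inverse of the denominator (1 - X)³ (1 - X - X²)².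
[denominator]⁻¹ : Series
[denominator]⁻¹ = [1-X]⁻¹ ^ 3 ⊛ [1-X-X²]⁻¹ ^ 2

denominator-inverse : (1-X ^ 3 ⊛ 1-X-X² ^ 2) ⊛ [denominator]⁻¹ ≋ const 1ℤ
denominator-inverse = begin
  (a ^ 3 ⊛ b ^ 2) ⊛ (a′ ^ 3 ⊛ b′ ^ 2)
    ≈⟨ solve 4 (λ a b a′ b′ →
         ((a :⊛ (a :⊛ (a :⊛ :1))) :⊛ (b :⊛ (b :⊛ :1))) :⊛ ((a′ :⊛ (a′ :⊛ (a′ :⊛ :1))) :⊛ (b′ :⊛ (b′ :⊛ :1)))
         ⊜
         ((a :⊛ a′) :⊛ ((a :⊛ a′) :⊛ (a :⊛ a′))) :⊛ ((b :⊛ b′) :⊛ (b :⊛ b′)))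
       ≋-refl a b a′ b′ ⟩
  ((a ⊛ a′) ⊛ ((a ⊛ a′) ⊛ (a ⊛ a′))) ⊛ ((b ⊛ b′) ⊛ (b ⊛ b′))
    ≈⟨ ⊛.∙-cong (⊛.∙-cong 1-X-inverse (⊛.∙-cong 1-X-inverse 1-X-inverse))
         (⊛.∙-cong 1-X-X²-inverse 1-X-X²-inverse) ⟩
  (const 1ℤ ⊛ (const 1ℤ ⊛ const 1ℤ)) ⊛ (const 1ℤ ⊛ const 1ℤ)
    ≈⟨ solve 0 (((:1 :⊛ (:1 :⊛ :1)) :⊛ (:1 :⊛ :1)) ⊜ :1) ≋-refl ⟩
  const 1ℤ ∎
  where
  open import Relation.Binary.Reasoning.Setoid ⊛.setoid
  a b a′ b′ : Series
  a = 1-X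
  b = 1-X-X²
  a′ = [1-X]⁻¹
  b′ = [1-X-X²]⁻¹

-- Each step expresses one of R, R₁, …, R₄ by the next one and the inverse of a factor
-- of the denominator; the last step collects the five inverses.
R-quotient : R ≈ X ⊛ P ÷ 1-X ^ 3 ⊛ 1-X-X² ^ 2
R-quotient = [denominator]⁻¹ , coefficients denominator-inverse , coefficients (begin
  R
    ≈⟨ divide 1-X a′ R 1-X-inverse (1-X-⊛ R) δR ⟩
  a′ ⊛ R₁
    ≈⟨ ⊛.∙-congˡ {a′} (divide 1-X-X² b′ R₁ 1-X-X²-inverse (1-X-X²-⊛ R₁) φR₁) ⟩
  a′ ⊛ (b′ ⊛ R₂)
    ≈⟨ ⊛.∙-congˡ {a′} (⊛.∙-congˡ {b′} (divide 1-X-X² b′ R₂ 1-X-X²-inverse (1-X-X²-⊛ R₂) φR₂)) ⟩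
  a′ ⊛ (b′ ⊛ (b′ ⊛ R₃))
    ≈⟨ ⊛.∙-congˡ {a′} (⊛.∙-congˡ {b′} (⊛.∙-congˡ {b′} (divide 1-X a′ R₃ 1-X-inverse (1-X-⊛ R₃) δR₃))) ⟩
  a′ ⊛ (b′ ⊛ (b′ ⊛ (a′ ⊛ R₄)))
    ≈⟨ ⊛.∙-congˡ {a′} (⊛.∙-congˡ {b′} (⊛.∙-congˡ {b′} (⊛.∙-congˡ {a′} (divide 1-X a′ R₄ 1-X-inverse (1-X-⊛ R₄) δR₄)))) ⟩
  a′ ⊛ (b′ ⊛ (b′ ⊛ (a′ ⊛ (a′ ⊛ R₅))))
    ≈⟨ ⊛.∙-congˡ {a′} (⊛.∙-congˡ {b′} (⊛.∙-congˡ {b′} (⊛.∙-congˡ {a′} (⊛.∙-congˡ {a′} X⊛P)))) ⟨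
  a′ ⊛ (b′ ⊛ (b′ ⊛ (a′ ⊛ (a′ ⊛ (X ⊛ P)))))
    ≈⟨ solve 3 (λ a b c →
         a :⊛ (b :⊛ (b :⊛ (a :⊛ (a :⊛ c))))
         ⊜
         c :⊛ ((a :⊛ (a :⊛ (a :⊛ :1))) :⊛ (b :⊛ (b :⊛ :1))))
       ≋-refl a′ b′ (X ⊛ P) ⟩
  (X ⊛ P) ⊛ [denominator]⁻¹ ∎)
  where
  open import Relation.Binary.Reasoning.Setoid ⊛.setoid
  a′ b′ : Series
  a′ = [1-X]⁻¹
  b′ = [1-X-X²]⁻¹

------------------------------------------------------------------------
-- Coefficients and the closed formula

first-coefficients : map R (upTo 11) ≡
  map +_ (0 ∷ 1 ∷ 2 ∷ 5 ∷ 12 ∷ 27 ∷ 56 ∷ 110 ∷ 207 ∷ 378 ∷ 675 ∷ [])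
-- The recursion for T is evaluated rather than the enumeration defining R.
first-coefficients = cong (0ℤ ∷_) (trans (map-cong R-suc (upTo 10)) refl)

-- Division by 5 of the closed formula for T.
fibonacci-formula : ∀ t c k → 5 * (t + 1 + c) ≡ k →
  + t / 1 ≡ + k / 5 - 1ℚ - + c / 1
fibonacci-formula t c k eq = ℚ.toℚᵘ-injective (begin
  toℚᵘ (+ t / 1)
    ≈⟨ ℚ.toℚᵘ-fromℚᵘ (mkℚᵘ (+ t) 0) ⟩
  mkℚᵘ (+ t) 0
    ≈⟨ *≡* (cross (+ t) (+ c) (+ k) eqℤ) ⟩
  mkℚᵘ (+ k) 4 ℚᵘ.- ℚᵘ.1ℚᵘ ℚᵘ.- mkℚᵘ (+ c) 0
    ≈⟨ ℚᵘ.+-cong (ℚᵘ.+-congˡ (ℚᵘ.- ℚᵘ.1ℚᵘ) (ℚ.toℚᵘ-fromℚᵘ (mkℚᵘ (+ k) 4)))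
         (ℚᵘ.-‿cong (ℚ.toℚᵘ-fromℚᵘ (mkℚᵘ (+ c) 0))) ⟨
  toℚᵘ (+ k / 5) ℚᵘ.- ℚᵘ.1ℚᵘ ℚᵘ.- toℚᵘ (+ c / 1)
    ≈⟨ ℚᵘ.+-cong (toℚᵘ-homo-- (+ k / 5) 1ℚ) (ℚᵘ.≃-refl {ℚᵘ.- toℚᵘ (+ c / 1)}) ⟨
  toℚᵘ (+ k / 5 - 1ℚ) ℚᵘ.- toℚᵘ (+ c / 1)
    ≈⟨ toℚᵘ-homo-- (+ k / 5 - 1ℚ) (+ c / 1) ⟨
  toℚᵘ (+ k / 5 - 1ℚ - + c / 1) ∎)
  where
  open ℚᵘ.≃-Reasoning
  toℚᵘ-homo-- : ∀ p q → toℚᵘ (p - q) ℚᵘ.≃ toℚᵘ p ℚᵘ.- toℚᵘ q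
  toℚᵘ-homo-- p q = ℚᵘ.≃-trans (ℚ.toℚᵘ-homo-+ p (ℚ.- q)) (ℚᵘ.+-congʳ (toℚᵘ p) (ℚ.toℚᵘ-homo‿- q))
  eqℤ : + 5 ℤ.* (+ t ℤ.+ 1ℤ ℤ.+ + c) ≡ + k
  eqℤ = trans (sym (ℤ.pos-* 5 (t + 1 + c))) (cong +_ eq)
  cross : ∀ t c k → + 5 ℤ.* (t ℤ.+ 1ℤ ℤ.+ c) ≡ k →
    t ℤ.* + 5 ≡ ((k ℤ.* 1ℤ ℤ.+ -[1+ 0 ] ℤ.* + 5) ℤ.* 1ℤ ℤ.+ (ℤ.- c) ℤ.* + 5) ℤ.* 1ℤ
  cross t c _ refl = expand t c
    where
    expand : ∀ t c → t ℤ.* + 5 ≡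
      ((+ 5 ℤ.* (t ℤ.+ 1ℤ ℤ.+ c) ℤ.* 1ℤ ℤ.+ -[1+ 0 ] ℤ.* + 5) ℤ.* 1ℤ ℤ.+ (ℤ.- c) ℤ.* + 5) ℤ.* 1ℤ
    expand = ℤ.solve-∀

theorem4p10 : (R ≈ X ⊛ (X ^ 6 ⊖ X ^ 5 ⊖ const (+ 3) ⊛ X ^ 4 ⊕ X ^ 3 ⊕ const (+ 3) ⊛ X ^ 2 ⊖ const (+ 3) ⊛ X ⊕ const (+ 1))
    ÷ (const (+ 1) ⊖ X) ^ 3 ⊛ (const (+ 1) ⊖ X ⊖ X ^ 2) ^ 2)
    × (map R (upTo 11) ≡ map +_ (0 ∷ 1 ∷ 2 ∷ 5 ∷ 12 ∷ 27 ∷ 56 ∷ 110 ∷ 207 ∷ 378 ∷ 675 ∷ []))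
    × ((n : ℕ) → let m = suc n in
    + ∣I∣ n 100-012 / 1
    ≡ + ((m + 7) * Fib m + 15 * Fib (m + 1) + m * Fib (m + 2)) / 5 - 1ℚ - + ((m + 2) C 2) / 1)
theorem4p10 = R-quotient , first-coefficients , λ n →
  trans (cong (λ t → + t / 1) (∣I∣≡T n))
        (fibonacci-formula (T (suc n)) ((suc n + 2) C 2) _ (T-closed (suc n)))
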